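{- Let $k_1,\dots,k_r$ be pairwise coprime odd integers with $k_i\ge 3$ for all $i$, such that $q=2k_1k_2\cdots k_r+1$ is a prime power. Then there exists a $\left(\frac{q-1}{2},\{k_1,\dots,k_r\}\right)$-MOHS.
   Context: Let $G$ be an abelian group of odd order $2v+1\ge 7$. A half-set of $G$ is a subset $V\subseteq G\setminus\{0\}$ containing exactly one element of each pair $\{g,-g\}$, $g\ne 0$ (so $|V|=v$). A $(v,k)$ Heffter system on $V$ is a partition of $V$ into blocks of size $k$, each block having sum $0$ in $G$. Two Heffter systems on the same half-set are orthogonal if every block of one meets every block of the other in at most one element. A $(v,\{k_1,\dots,k_r\})$-MOHS is a set $\{\mathcal P_1,\dots,\mathcal P_r\}$ of pairwise orthogonal Heffter systems on a common half-set of some abelian group of order $2v+1$, where $\mathcal P_i$ is a $(v,k_i)$ Heffter system. -}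

module Defs where

open import Level using (0ℓ)
open import Algebra.Bundles using (AbelianGroup)
import Algebra.Properties.CommutativeMonoid.Sum as CMSum
open import Data.Bool.Base using (if_then_else_)
open import Data.Fin.Base using (Fin)
open import Data.Fin.Subset using (Subset; _∩_; ⋃; ∣_∣; Nonempty; Empty)
  renaming (_∈_ to _∈ˢ_)
open import Data.List.Base as List using (List; tabulate)
open import Data.List.Membership.Propositional using (_∈_)
open import Data.List.Relation.Unary.All using (All)
open import Data.List.Relation.Unary.AllPairs using (AllPairs)
open import Data.Nat.Base using (ℕ; _+_; _*_; _^_; _≤_)
open import Data.Nat.Primality using (Prime)
open import Data.Product.Base using (∃₂; _×_)
open import Data.Sum.Base using (_⊎_)
open import Data.Vec.Base using (lookup)
open import Function.Bundles using (Inverse)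
open import Relation.Binary.PropositionalEquality.Core using (_≡_; _≢_)
open import Relation.Binary.PropositionalEquality.Properties using (setoid)
open import Relation.Nullary.Negation.Core using (¬_)

IsPrimePower : ℕ → Set
IsPrimePower q = ∃₂ λ p m → Prime p × 1 ≤ m × q ≡ p ^ m

∏ : ∀ {r} → (Fin r → ℕ) → ℕ
∏ k = List.product (tabulate k)

-- The carrier is a setoid, so "order n" means that Fin n is in bijection with
-- the carrier modulo _≈_.
record AbelianGroupOfOrder (n : ℕ) : Set₁ where
  field
    abelianGroup : AbelianGroup 0ℓ 0ℓ
  open AbelianGroup abelianGroup public
    using (Carrier; _≈_; _∙_; ε; _⁻¹; commutativeMonoid)
  field
    enumeration : Inverse (setoid (Fin n)) (AbelianGroup.setoid abelianGroup)

-- Subsets of G are given by the indices of their elements in the enumeration,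
-- so that the stdlib operations on Subset n (∩, ⋃, ∣_∣) apply to them.
module _ {n : ℕ} (G : AbelianGroupOfOrder n) where
  open AbelianGroupOfOrder G
  open Inverse enumeration using (to; from)

  infix 4 _∈ᴳ_
  _∈ᴳ_ : Carrier → Subset n → Set
  g ∈ᴳ S = from g ∈ˢ S

  ΣG : Subset n → Carrier
  ΣG S = CMSum.sum commutativeMonoid (λ i → if lookup S i then to i else ε)

  record IsHalfSet (V : Subset n) : Set where
    field
      ε∉V       : ¬ (ε ∈ᴳ V)
      oneOfPair : ∀ g → ¬ (g ≈ ε) →
                  (g ∈ᴳ V × ¬ (g ⁻¹ ∈ᴳ V)) ⊎ (¬ (g ∈ᴳ V) × g ⁻¹ ∈ᴳ V)

  record IsPartition (V : Subset n) (blocks : List (Subset n)) : Set where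
    field
      nonempty : All Nonempty blocks
      disjoint : AllPairs (λ B C → Empty (B ∩ C)) blocks
      union    : ⋃ blocks ≡ V

  record IsHeffterSystem (V : Subset n) (k : ℕ) (P : List (Subset n)) : Set where
    field
      partition : IsPartition V P
      blockSize : ∀ {B} → B ∈ P → ∣ B ∣ ≡ k
      zeroSum   : ∀ {B} → B ∈ P → ΣG B ≈ ε

Orthogonal : ∀ {n} → List (Subset n) → List (Subset n) → Set
Orthogonal P Q = ∀ {B C} → B ∈ P → C ∈ Q → ∣ B ∩ C ∣ ≤ 1

record MOHS (v : ℕ) {r : ℕ} (k : Fin r → ℕ) : Set₁ where
  field
    order≥7    : 7 ≤ 2 * v + 1
    group      : AbelianGroupOfOrder (2 * v + 1)
    V          : Subset (2 * v + 1)
    halfSet    : IsHalfSet group V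
    systems    : Fin r → List (Subset (2 * v + 1))
    heffter    : ∀ i → IsHeffterSystem group V (k i) (systems i)
    orthogonal : ∀ i j → i ≢ j → Orthogonal (systems i) (systems j)

{-# OPTIONS --safe #-}
module Submission where

-- Let ψ generate the multiplicative group of a field with q = 2v + 1 elements,
-- v = k₁⋯kᵣ. Since v is odd, the even powers of ψ form a half-set. For each kᵢ
-- they split into the cosets of the subgroup of order kᵢ; a coset sum is fixed
-- by multiplication by a nontrivial element of that subgroup, hence vanishes, and
-- cosets of subgroups of coprime orders meet in at most one element.
--
-- The field is realised by linear recurring sequences. Put M = q − 1 and let
-- polynomials in the shift X act on M-periodic sequences u over ℤ/p; modulo the
-- annihilator of u they form a ring in which y^q = y, by Frobenius and X^M = 1.
-- Replacing u by a·u makes a invertible and replacing it by (1 − a^M)·u makes a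
-- zero; relations already valid persist. First all 1 − X^(M/l), l ∣ M prime,
-- become invertible: applied to the indicator sequence of M ∣ n, their product
-- still has value 1 at 0. Hence X has order exactly M. Then, for all
-- r, s, t in T = {0} ∪ {X^i}, r + s − t becomes either zero or invertible, while
-- u stays nonzero. As y^q − y = ∏ (y − t) over t ∈ T vanishes, T is closed under
-- addition, so that T is the whole ring.
open import Defs
open import Level using (0ℓ)
open import Algebra.Bundles using (CommutativeMonoid; CommutativeRing; CommutativeSemiring)
import Algebra.Properties.CommutativeMonoid.Mult as CMMult
import Algebra.Properties.CommutativeMonoid.Sum as CMSum
import Algebra.Properties.CommutativeSemigroup as CommutativeSemigroupProperties
import Algebra.Properties.CommutativeSemiring.Binomial as Binomial
import Algebra.Properties.CommutativeSemiring.Exp as Exp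
import Algebra.Properties.Group as GroupProperties
import Algebra.Properties.Ring as RingProperties
import Algebra.Properties.Semiring.Mult as SemiringMult
import Algebra.Properties.Semiring.Sum as SemiringSum
open import Data.Bool.Base using (Bool; true; false; if_then_else_)
open import Data.Fin.Base using (Fin; zero; suc; toℕ; fromℕ; fromℕ<; inject₁)
open import Data.Fin.Properties using (_≟_; suc-injective; toℕ-fromℕ; toℕ-fromℕ<; toℕ-injective; toℕ-inject₁; toℕ<n)
open import Data.Fin.Subset using (Subset; _∩_; ⋃; ∣_∣; Empty; Nonempty; inside; outside) renaming (_∈_ to _∈ˢ_)
open import Data.Fin.Subset.Properties using (∉⊥; ∣⊥∣≡0; ⊆-antisym; Empty-unique; x∈p∩q⁻; x∈p∪q⁺; x∈p∪q⁻)
open import Data.List.Base as List using (List; []; _∷_)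
open import Data.List.Membership.Propositional using (_∈_)
open import Data.List.Membership.Propositional.Properties using (∈-allFin; ∈-cartesianProductWith⁺; ∈-map⁺; ∈-tabulate⁺; ∈-tabulate⁻)
open import Data.List.Relation.Unary.All as All using (All; []; _∷_)
import Data.List.Relation.Unary.All.Properties as AllProperties
import Data.List.Relation.Unary.AllPairs.Properties as AllPairsProperties
open import Data.List.Relation.Unary.Any using (here; there)
open import Data.Nat.Base as ℕ using (ℕ; zero; suc; _∸_; _!; _≤_; _<_; z≤n; s≤s; z<s; s<s; NonZero; >-nonZero; parity)
open import Data.Nat.Combinatorics using (_C_; nCk≡n!/k![n-k]!; nCn≡1; [n∸k]!k!∣n!)
open import Data.Nat.Coprimality using (Coprime; coprime⇒gcd≡1)
open import Data.Nat.Divisibility as ℕ using (_∣_; _∣?_; divides; ∣⇒≤; ∣1⇒≡1; ∣m∣n⇒∣m+n; ∣m+n∣m⇒∣n)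
open import Data.Nat.DivMod using (_/_; _%_; %-distribˡ-+; %-distribˡ-*; [m+n]%n≡m%n; m%n<n; m<n⇒m%n≡m; m<n*o⇒m/o<n; m≡m%n+[m/n]*n; m*n/n≡m; m*n%n≡0; m/n*n≡m; m∣n⇒o%n%m≡o%m)
open import Data.Nat.GCD using (gcd; gcd-GCD; gcd-greatest; gcd[m,n]∣m; gcd[m,n]∣n; c*gcd[m,n]≡gcd[cm,cn]; module Bézout)
open import Data.Nat.Primality using (Prime; prime?; euclidsLemma; prime⇒nonZero; ¬prime[0]; ¬prime[1])
open import Data.Nat.Primality.Factorisation using (factorise)
import Data.Nat.Properties as ℕ
open import Data.Parity.Base using (1ℙ)
open import Data.Product.Base using (∃; _,_; proj₁; proj₂) renaming (_×_ to _∧_)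
open import Data.Sum.Base as Sum using (_⊎_; inj₁; inj₂)
open import Data.Vec.Base as Vec using ([]; _∷_; lookup)
open import Data.Vec.Properties using (lookup∘tabulate; []=⇒lookup; lookup⇒[]=)
open import Function.Base using (_∘_; id)
open import Function.Bundles using (Inverse)
open import Relation.Binary.Definitions using (Decidable; tri<; tri≈; tri>)
open import Relation.Binary.PropositionalEquality.Core as ≡ using (_≡_; _≢_)
open import Relation.Binary.PropositionalEquality.Properties using (module ≡-Reasoning)
import Relation.Binary.Reasoning.Setoid as SetoidReasoning
open import Relation.Nullary.Decidable using (yes; no; does; dec-false; dec-true; map′; _×-dec_)
open import Relation.Nullary.Negation.Core using (¬_; contradiction)

-- Prime divisors of factorials and binomial coefficients.

prime∤! : ∀ {p} → Prime p → ∀ k → k < p → ¬ (p ∣ k !)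
prime∤! pr zero _ p∣1 = ¬prime[1] (≡.subst Prime (∣1⇒≡1 p∣1) pr)
prime∤! pr (suc k) k<p p∣k! with euclidsLemma (suc k) (k !) pr p∣k!
... | inj₁ p∣1+k = ℕ.<⇒≱ k<p (∣⇒≤ p∣1+k)
... | inj₂ p∣k!′ = prime∤! pr k (ℕ.<-trans (ℕ.n<1+n k) k<p) p∣k!′

-- `p` divides `p ! = (p C k) * k ! * (p ∸ k) !` and, by `prime∤!`, neither of the two factorials.
prime∣C : ∀ {p} → Prime p → ∀ k → 0 < k → k < p → p ∣ p C k
prime∣C {suc p} pr k 0<k k<p
  with euclidsLemma (suc p C k) (k ! ℕ.* (suc p ∸ k) !) pr
         (≡.subst (suc p ∣_) (≡.sym C*k![p∸k]!≡p!) (ℕ.m∣m*n (p !)))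
  where
  instance _ = k ℕ.!* (suc p ∸ k) !≢0
  C*k![p∸k]!≡p! : (suc p C k) ℕ.* (k ! ℕ.* (suc p ∸ k) !) ≡ suc p !
  C*k![p∸k]!≡p! = ≡.trans
    (≡.cong (ℕ._* (k ! ℕ.* (suc p ∸ k) !)) (nCk≡n!/k![n-k]! (ℕ.<⇒≤ k<p)))
    (m/n*n≡m (≡.subst (_∣ suc p !) (ℕ.*-comm ((suc p ∸ k) !) (k !)) ([n∸k]!k!∣n! (ℕ.<⇒≤ k<p))))
... | inj₁ p∣C = p∣C
... | inj₂ p∣k![p∸k]! with euclidsLemma (k !) ((suc p ∸ k) !) pr p∣k![p∸k]!
... | inj₁ p∣k! = contradiction p∣k! (prime∤! pr k k<p)
... | inj₂ p∣[p∸k]! = contradiction p∣[p∸k]!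
  (prime∤! pr (suc p ∸ k) (ℕ.∸-monoʳ-< 0<k (ℕ.<⇒≤ k<p)))

-- The Frobenius map in characteristic `p`.

module Frobenius (S : CommutativeSemiring 0ℓ 0ℓ) where
  open CommutativeSemiring S hiding (zero)
  open Exp S
  open SemiringMult semiring using (×-cong; ×-homo-1; ×-assocˡ; ×-congʳ)
  open import Algebra.Definitions.RawMonoid +-rawMonoid using (_×_)
  open CMSum +-commutativeMonoid using (sum; sum-init-last; sum-cong-≋; sum-replicate-zero)
  open SetoidReasoning setoid

  module _ {p} (prime-p : Prime p) (char : ∀ x → p × x ≈ 0#) where

    ∣⇒×≈0 : ∀ {n} → p ∣ n → ∀ x → n × x ≈ 0#
    ∣⇒×≈0 (divides c ≡.refl) x = begin
      (c ℕ.* p) × x   ≈⟨ ×-cong (ℕ.*-comm c p) refl ⟩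
      (p ℕ.* c) × x   ≈⟨ ×-assocˡ x p c ⟨
      p × (c × x)     ≈⟨ char (c × x) ⟩
      0#              ∎

  -- All inner binomial coefficients are divisible by `p` (`prime∣C`), so only the two outer terms
  -- of the binomial expansion survive.
  ^-distrib-+ : ∀ {p} → Prime p → (∀ x → p × x ≈ 0#) →
                ∀ x y → (x + y) ^ p ≈ x ^ p + y ^ p
  ^-distrib-+ {zero} pr _ _ _ = contradiction pr ¬prime[0]
  ^-distrib-+ {suc zero} pr _ _ _ = contradiction pr ¬prime[1]
  ^-distrib-+ {suc (suc n)} pr char x y = begin
    (x + y) ^ p                                   ≈⟨ Binomial.theorem S p x y ⟩
    term zero + sum (term ∘ suc)                  ≈⟨ +-congˡ (sum-init-last (term ∘ suc)) ⟩
    term zero + (sum {suc n} (term ∘ suc ∘ inject₁) + term (suc (fromℕ (suc n))))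
      ≈⟨ +-cong first (+-cong (trans (sum-cong-≋ middle) (sum-replicate-zero (suc n))) last) ⟩
    y ^ p + (0# + x ^ p)                          ≈⟨ +-congˡ (+-identityˡ _) ⟩
    y ^ p + x ^ p                                 ≈⟨ +-comm _ _ ⟩
    x ^ p + y ^ p                                 ∎
    where
    p = suc (suc n)
    term : Fin (suc p) → Carrier
    term = Binomial.binomialTerm S x y p
    first : term zero ≈ y ^ p
    first = trans (×-homo-1 _) (*-identityˡ _)
    last : term (suc (fromℕ (suc n))) ≈ x ^ p
    last rewrite toℕ-fromℕ n | nCn≡1 p | ℕ.n∸n≡0 n = trans (×-homo-1 _) (*-identityʳ _)
    middle : ∀ i → term (suc (inject₁ i)) ≈ 0#
    middle i = ∣⇒×≈0 pr char (prime∣C pr _ z<s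
      (s<s (≡.subst (_< suc n) (≡.sym (toℕ-inject₁ i)) (toℕ<n i)))) _

  ^p^m-distrib-+ : ∀ {p} → Prime p → (∀ x → p × x ≈ 0#) →
                   ∀ m x y → (x + y) ^ (p ℕ.^ m) ≈ x ^ (p ℕ.^ m) + y ^ (p ℕ.^ m)
  ^p^m-distrib-+ pr char zero x y = begin
    (x + y) * 1#       ≈⟨ distribʳ _ _ _ ⟩
    x * 1# + y * 1#    ∎
  ^p^m-distrib-+ {p} pr char (suc m) x y = begin
    (x + y) ^ (p ℕ.* pᵐ)                ≈⟨ ^-assocʳ _ p pᵐ ⟨
    ((x + y) ^ p) ^ pᵐ                  ≈⟨ ^-congˡ pᵐ (^-distrib-+ pr char x y) ⟩
    (x ^ p + y ^ p) ^ pᵐ                ≈⟨ ^p^m-distrib-+ pr char m _ _ ⟩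
    (x ^ p) ^ pᵐ + (y ^ p) ^ pᵐ         ≈⟨ +-cong (^-assocʳ _ p pᵐ) (^-assocʳ _ p pᵐ) ⟩
    x ^ (p ℕ.* pᵐ) + y ^ (p ℕ.* pᵐ)     ∎
    where pᵐ = p ℕ.^ m

-- Monic polynomial functions over a commutative ring.

module MonicPolynomials (K : CommutativeRing 0ℓ 0ℓ) where
  open CommutativeRing K hiding (zero)
  open Exp commutativeSemiring using (_^_)
  open RingProperties ring using ([y-z]x≈yx-zx; x[y-z]≈xy-xz)
  open CMSum *-commutativeMonoid using () renaming (sum to product)
  open SetoidReasoning setoid

  Unit : Carrier → Set
  Unit x = ∃ λ y → x * y ≈ 1#

  x-y+y≈x : ∀ x y → (x - y) + y ≈ x
  x-y+y≈x x y = trans (+-assoc x (- y) y) (trans (+-congˡ (-‿inverseˡ y)) (+-identityʳ x))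

  x*y≈x⇒x*[1-y]≈0 : ∀ {x y} → x * y ≈ x → x * (1# - y) ≈ 0#
  x*y≈x⇒x*[1-y]≈0 {x} {y} xy≈x = begin
    x * (1# - y)      ≈⟨ x[y-z]≈xy-xz x 1# y ⟩
    x * 1# - x * y    ≈⟨ +-cong (*-identityʳ x) (-‿cong xy≈x) ⟩
    x - x             ≈⟨ -‿inverseʳ x ⟩
    0#                ∎

  -- Polynomials occur only as functions. Each `step` is one step of Horner's scheme with new
  -- constant coefficient `c`; the innermost `one` is the leading coefficient.
  data Monic : ℕ → (Carrier → Carrier) → Set where
    one  : ∀ {f} → (∀ y → f y ≈ 1#) → Monic 0 f
    step : ∀ {n f g} c → Monic n g → (∀ y → f y ≈ y * g y + c) → Monic (suc n) f

  ^-monic : ∀ n → Monic n (_^ n)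
  ^-monic zero    = one (λ _ → refl)
  ^-monic (suc n) = step 0# (^-monic n) (λ y → sym (+-identityʳ _))

  private
    -- The inductive step of synthetic division, with `k` the previous quotient and `g` the previous
    -- remainder: `y * g` is expanded as `((y - t) + t) * g`.
    y*-absorb : ∀ y t k g c → y * ((y - t) * k + g) + c ≈ (y - t) * (y * k + g) + (t * g + c)
    y*-absorb y t k g c = begin
      y * ((y - t) * k + g) + c                      ≈⟨ +-congʳ (distribˡ _ _ _) ⟩
      (y * ((y - t) * k) + y * g) + c                ≈⟨ +-congʳ (+-cong y[y-t]k (*-congʳ (sym (x-y+y≈x y t)))) ⟩
      ((y - t) * (y * k) + ((y - t) + t) * g) + c    ≈⟨ +-congʳ (+-congˡ (distribʳ _ _ _)) ⟩
      ((y - t) * (y * k) + ((y - t) * g + t * g)) + c ≈⟨ +-congʳ (+-assoc _ _ _) ⟨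
      (((y - t) * (y * k) + (y - t) * g) + t * g) + c ≈⟨ +-assoc _ _ _ ⟩
      ((y - t) * (y * k) + (y - t) * g) + (t * g + c) ≈⟨ +-congʳ (distribˡ _ _ _) ⟨
      (y - t) * (y * k + g) + (t * g + c)            ∎
      where
      y[y-t]k : y * ((y - t) * k) ≈ (y - t) * (y * k)
      y[y-t]k = trans (sym (*-assoc _ _ _)) (trans (*-congʳ (*-comm _ _)) (*-assoc _ _ _))

  -- The coefficients of the quotient are the values at `t` of the successive Horner stages; the
  -- last such value, `f t`, is the remainder.
  divide : ∀ {n f} → Monic (suc n) f → ∀ t →
           ∃ λ h → Monic n h ∧ (∀ y → f y ≈ (y - t) * h y + f t)
  divide {zero} {f} (step {g = g} c (one g≈1) f≈) t = (λ _ → 1#) , one (λ _ → refl) , λ y → begin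
    f y                          ≈⟨ f≈ y ⟩
    y * g y + c                  ≈⟨ +-congʳ (*-cong (sym (x-y+y≈x y t)) (g≈1 y)) ⟩
    ((y - t) + t) * 1# + c       ≈⟨ +-congʳ (distribʳ _ _ _) ⟩
    (y - t) * 1# + t * 1# + c    ≈⟨ +-assoc _ _ _ ⟩
    (y - t) * 1# + (t * 1# + c)  ≈⟨ +-congˡ (+-congʳ (*-congˡ (g≈1 t))) ⟨
    (y - t) * 1# + (t * g t + c) ≈⟨ +-congˡ (f≈ t) ⟨
    (y - t) * 1# + f t           ∎
  divide {suc n} {f} (step {g = g} c monic f≈) t with divide monic t
  ... | k , monic-k , g≈ = (λ y → y * k y + g t) , step (g t) monic-k (λ _ → refl) , λ y → begin
    f y                                       ≈⟨ f≈ y ⟩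
    y * g y + c                               ≈⟨ +-congʳ (*-congˡ (g≈ y)) ⟩
    y * ((y - t) * k y + g t) + c             ≈⟨ y*-absorb y t (k y) (g t) c ⟩
    (y - t) * (y * k y + g t) + (t * g t + c) ≈⟨ +-congˡ (f≈ t) ⟨
    (y - t) * (y * k y + g t) + f t           ∎

  Regular : Carrier → Set
  Regular x = ∀ z → x * z ≈ 0# → z ≈ 0#

  -- With zero divisors around, distinct roots need not split off one after the other. Here
  -- `t (suc i)` remains a root of the quotient by `y - t zero` because `t (suc i) - t zero` is
  -- regular.
  monic≈product : ∀ {n f} → Monic n f → (t : Fin n → Carrier) →
                  (∀ i j → i ≢ j → Regular (t i - t j)) → (∀ i → f (t i) ≈ 0#) →
                  ∀ y → f y ≈ product (λ i → y - t i)
  monic≈product (one f≈1) t regular root y = f≈1 y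
  monic≈product {suc n} {f} monic t regular root y with divide monic (t zero)
  ... | h , monic-h , f≈ = begin
    f y                                     ≈⟨ f≈h y ⟩
    (y - t zero) * h y                      ≈⟨ *-congˡ (monic≈product monic-h (t ∘ suc)
      (λ i j i≢j → regular (suc i) (suc j) (i≢j ∘ suc-injective)) root-h y) ⟩
    product (λ i → y - t i)                 ∎
    where
    f≈h : ∀ y → f y ≈ (y - t zero) * h y
    f≈h y = trans (f≈ y) (trans (+-congˡ (root zero)) (+-identityʳ _))
    root-h : ∀ i → h (t (suc i)) ≈ 0#
    root-h i = regular (suc i) zero (λ ()) _ (trans (sym (f≈h _)) (root (suc i)))

  -- A substitute for the absence of zero divisors: in a nontrivial ring, if such a product
  -- vanishes, then so does one of its factors.
  product-unit : ∀ {n} (x : Fin n → Carrier) → (∀ i → x i ≈ 0# ⊎ Unit (x i)) →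
                 (∃ λ i → x i ≈ 0#) ⊎ Unit (product x)
  product-unit {zero}  x _ = inj₂ (1# , *-identityˡ 1#)
  product-unit {suc n} x zeroOrUnit with zeroOrUnit zero | product-unit (x ∘ suc) (zeroOrUnit ∘ suc)
  ... | inj₁ x₀≈0     | _              = inj₁ (zero , x₀≈0)
  ... | inj₂ _        | inj₁ (i , xᵢ≈0) = inj₁ (suc i , xᵢ≈0)
  ... | inj₂ (y , xy) | inj₂ (z , Pz)  = inj₂ (y * z , (begin
    (x zero * product (x ∘ suc)) * (y * z) ≈⟨ *-assoc _ _ _ ⟩
    x zero * (product (x ∘ suc) * (y * z)) ≈⟨ *-congˡ (trans (*-congˡ (*-comm y z)) (sym (*-assoc _ _ _))) ⟩
    x zero * ((product (x ∘ suc) * z) * y) ≈⟨ *-congˡ (trans (*-congʳ Pz) (*-identityˡ y)) ⟩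
    x zero * y                             ≈⟨ xy ⟩
    1#                                     ∎))

-- Shift operators acting on sequences.

infixl 6 _⊕_
infixl 7 _⊗_

-- Polynomials in the shift X over ℤ/p: constants are sums of 𝟙, and −a is the
-- (p − 1)-fold sum of a.
data Operator : Set where
  𝟘 𝟙 X   : Operator
  _⊕_ _⊗_ : Operator → Operator → Operator

infixr 8 _×ᵒ_
_×ᵒ_ : ℕ → Operator → Operator
zero  ×ᵒ a = 𝟘
suc n ×ᵒ a = a ⊕ (n ×ᵒ a)

X^_ : ℕ → Operator
X^ zero  = 𝟙
X^ suc n = X ⊗ (X^ n)

HasExponent : CommutativeMonoid 0ℓ 0ℓ → ℕ → Set
HasExponent A n = ∀ a → n × a ≈ ε
  where
  open CommutativeMonoid A
  open CMMult A using (_×_)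

module ShiftOperators (A : CommutativeMonoid 0ℓ 0ℓ) (p-1 : ℕ) (char : HasExponent A (suc p-1)) where

  open CommutativeMonoid A
  open CMMult A using (_×_; ×-congʳ)
  open CommutativeSemigroupProperties commutativeSemigroup using (interchange)
  open SetoidReasoning setoid

  Sequence : Set
  Sequence = ℕ → Carrier

  act : Operator → Sequence → Sequence
  act 𝟘       u n = ε
  act 𝟙       u n = u n
  act X       u n = u (suc n)
  act (a ⊕ b) u n = act a u n ∙ act b u n
  act (a ⊗ b) u n = act a (act b u) n

  act-cong : ∀ a {u w} → (∀ n → u n ≈ w n) → ∀ n → act a u n ≈ act a w n
  act-cong 𝟘       u≈w n = refl
  act-cong 𝟙       u≈w n = u≈w n
  act-cong X       u≈w n = u≈w (suc n)
  act-cong (a ⊕ b) u≈w n = ∙-cong (act-cong a u≈w n) (act-cong b u≈w n)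
  act-cong (a ⊗ b) u≈w n = act-cong a (act-cong b u≈w) n

  act-ε : ∀ a n → act a (λ _ → ε) n ≈ ε
  act-ε 𝟘       n = refl
  act-ε 𝟙       n = refl
  act-ε X       n = refl
  act-ε (a ⊕ b) n = trans (∙-cong (act-ε a n) (act-ε b n)) (identityˡ ε)
  act-ε (a ⊗ b) n = trans (act-cong a (act-ε b) n) (act-ε a n)

  act-∙ : ∀ a u w n → act a (λ m → u m ∙ w m) n ≈ act a u n ∙ act a w n
  act-∙ 𝟘       u w n = sym (identityˡ ε)
  act-∙ 𝟙       u w n = refl
  act-∙ X       u w n = refl
  act-∙ (a ⊕ b) u w n = trans (∙-cong (act-∙ a u w n) (act-∙ b u w n)) (interchange _ _ _ _)
  act-∙ (a ⊗ b) u w n = trans (act-cong a (act-∙ b u w) n) (act-∙ a (act b u) (act b w) n)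

  act-suc : ∀ a u n → act a (u ∘ suc) n ≈ act a u (suc n)
  act-suc 𝟘       u n = refl
  act-suc 𝟙       u n = refl
  act-suc X       u n = refl
  act-suc (a ⊕ b) u n = ∙-cong (act-suc a u n) (act-suc b u n)
  act-suc (a ⊗ b) u n = trans (act-cong a (act-suc b u) n) (act-suc a (act b u) n)

  -- Every operator is generated by the shift, and `act-suc` is commutation with the shift; sums and
  -- compositions inherit it.
  act-comm : ∀ a b u n → act a (act b u) n ≈ act b (act a u) n
  act-comm 𝟘       b u n = sym (act-ε b n)
  act-comm 𝟙       b u n = refl
  act-comm X       b u n = sym (act-suc b u n)
  act-comm (a ⊕ c) b u n = trans (∙-cong (act-comm a b u n) (act-comm c b u n)) (sym (act-∙ b (act a u) (act c u) n))
  act-comm (a ⊗ c) b u n = trans (act-cong a (act-comm c b u) n) (act-comm a b (act c u) n)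

  act-×ᵒ : ∀ k a u n → act (k ×ᵒ a) u n ≈ k × act a u n
  act-×ᵒ zero    a u n = refl
  act-×ᵒ (suc k) a u n = ∙-congˡ (act-×ᵒ k a u n)

  act-X^ : ∀ k u n → act (X^ k) u n ≈ u (k ℕ.+ n)
  act-X^ zero    u n = refl
  act-X^ (suc k) u n = trans (act-X^ k u (suc n)) (reflexive (≡.cong u (ℕ.+-suc k n)))

  ⊖_ : Operator → Operator
  ⊖ a = p-1 ×ᵒ a

  infix 4 _≈[_]_
  -- Equality modulo the annihilator of `u`. Being a record and not a bare function type, it lets
  -- `a`, `u` and `b` be inferred from a proof.
  record _≈[_]_ (a : Operator) (u : Sequence) (b : Operator) : Set where
    constructor agree
    field
      at : ∀ n → act a u n ≈ act b u n

  open _≈[_]_ public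

  -- Since operators commute, whatever annihilates `u` also annihilates `act c u`. This makes
  -- multiplication well defined in the quotient ring and lets relations survive refinement.
  ≈-act : ∀ c {u a b} → a ≈[ u ] b → a ≈[ act c u ] b
  ≈-act c {u} {a} {b} a≈b .at n = begin
    act a (act c u) n   ≈⟨ act-comm a c u n ⟩
    act c (act a u) n   ≈⟨ act-cong c (a≈b .at) n ⟩
    act c (act b u) n   ≈⟨ act-comm c b u n ⟩
    act b (act c u) n   ∎

  cyclicRing : Sequence → CommutativeRing 0ℓ 0ℓ
  cyclicRing u = record
    { Carrier = Operator
    ; _≈_ = _≈[ u ]_
    ; _+_ = _⊕_
    ; _*_ = _⊗_
    ; -_ = ⊖_
    ; 0# = 𝟘
    ; 1# = 𝟙
    ; isCommutativeRing = record
      { isRing = record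
        { +-isAbelianGroup = record
          { isGroup = record
            { isMonoid = record
              { isSemigroup = record
                { isMagma = record
                  { isEquivalence = record
                    { refl = agree λ n → refl
                    ; sym = λ a≈b → agree λ n → sym (a≈b .at n)
                    ; trans = λ a≈b b≈c → agree λ n → trans (a≈b .at n) (b≈c .at n)
                    }
                  ; ∙-cong = λ a≈b c≈d → agree λ n → ∙-cong (a≈b .at n) (c≈d .at n)
                  }
                ; assoc = λ a b c → agree λ n → assoc _ _ _
                }
              ; identity = (λ a → agree λ n → identityˡ _) , (λ a → agree λ n → identityʳ _)
              }
            ; inverse = (λ a → agree λ n → trans (comm _ _) (inverseʳ a n)) , λ a → agree (inverseʳ a)
            ; ⁻¹-cong = λ {a} {b} a≈b → agree λ n → trans (act-×ᵒ p-1 a u n)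
                (trans (×-congʳ p-1 (a≈b .at n)) (sym (act-×ᵒ p-1 b u n)))
            }
          ; comm = λ a b → agree λ n → comm _ _
          }
        ; *-cong = λ {a} {b} {c} {d} a≈b c≈d → agree λ n →
            trans (act-cong a (c≈d .at) n) (≈-act d a≈b .at n)
        ; *-assoc = λ a b c → agree λ n → refl
        ; *-identity = (λ a → agree λ n → refl) , (λ a → agree λ n → refl)
        ; distrib = (λ a b c → agree (act-∙ a (act b u) (act c u))) , (λ a b c → agree λ n → refl)
        }
      ; *-comm = λ a b → agree (act-comm a b u)
      }
    }
    where
    inverseʳ : ∀ a n → act a u n ∙ act (⊖ a) u n ≈ ε
    inverseʳ a n = trans (∙-congˡ (act-×ᵒ p-1 a u n)) (char (act a u n))

  Refines : Sequence → Sequence → Set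
  Refines u w = ∀ {a b} → a ≈[ u ] b → a ≈[ w ] b

  Invertible : Sequence → Operator → Set
  Invertible u = MonicPolynomials.Unit (cyclicRing u)

  ZeroOrUnit : Sequence → Operator → Set
  ZeroOrUnit u a = a ≈[ u ] 𝟘 ⊎ Invertible u a

  refine-unit : ∀ {u w a} → Refines u w → Invertible u a → Invertible w a
  refine-unit u⊒w (b , ab≈1) = b , u⊒w ab≈1

  refine-zeroOrUnit : ∀ {u w a} → Refines u w → ZeroOrUnit u a → ZeroOrUnit w a
  refine-zeroOrUnit u⊒w = Sum.map u⊒w (refine-unit u⊒w)

  -- Periodic sequences and their refinement.

  module Periodicity (M-1 : ℕ) where

    M q : ℕ
    M = suc M-1
    q = suc M

    Periodic : Sequence → Set
    Periodic u = ∀ n → u (M ℕ.+ n) ≈ u n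

    periodic-* : ∀ {u} → Periodic u → ∀ k n → u (k ℕ.* M ℕ.+ n) ≈ u n
    periodic-* per zero    n = refl
    periodic-* {u} per (suc k) n = begin
      u (M ℕ.+ k ℕ.* M ℕ.+ n)     ≡⟨ ≡.cong u (ℕ.+-assoc M (k ℕ.* M) n) ⟩
      u (M ℕ.+ (k ℕ.* M ℕ.+ n))   ≈⟨ per _ ⟩
      u (k ℕ.* M ℕ.+ n)           ≈⟨ periodic-* per k n ⟩
      u n                         ∎

    act-periodic : ∀ a {u} → Periodic u → Periodic (act a u)
    act-periodic a {u} per n = begin
      act a u (M ℕ.+ n)          ≈⟨ act-X^ M (act a u) n ⟨
      act (X^ M) (act a u) n     ≈⟨ act-comm (X^ M) a u n ⟩
      act a (act (X^ M) u) n     ≈⟨ act-cong a (λ m → trans (act-X^ M u m) (per m)) n ⟩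
      act a u n                  ∎

    periodic-% : ∀ {u} → Periodic u → ∀ n → u n ≈ u (n % M)
    periodic-% {u} per n = begin
      u n                              ≡⟨ ≡.cong u (≡.trans (m≡m%n+[m/n]*n n M) (ℕ.+-comm (n % M) _)) ⟩
      u (n / M ℕ.* M ℕ.+ n % M)        ≈⟨ periodic-* per (n / M) (n % M) ⟩
      u (n % M)                        ∎

    module Refinement (_≟_ : Decidable _≈_)
      (p-prime : Prime (suc p-1)) (m : ℕ) (q≡p^m : q ≡ suc p-1 ℕ.^ m) where

      -- Both sides have period `M`, so comparing their first `M` values decides.
      ≈-dec : ∀ {u} → Periodic u → Decidable _≈[ u ]_
      ≈-dec {u} per a b = map′
        (λ a≈b → agree λ n → begin
          act a u n        ≈⟨ periodic-% (act-periodic a per) n ⟩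
          act a u (n % M)  ≈⟨ a≈b (m%n<n n M) ⟩
          act b u (n % M)  ≈⟨ periodic-% (act-periodic b per) n ⟨
          act b u n        ∎)
        (λ a≈b {n} _ → a≈b .at n)
        (ℕ.allUpTo? (λ n → act a u n ≟ act b u n) M)

      module _ {u : Sequence} (per : Periodic u) where
        private
          module R = CommutativeRing (cyclicRing u)
        open Exp R.commutativeSemiring using (_^_; ^-distrib-*)
        open GroupProperties R.+-group using () renaming (x∙y⁻¹≈ε⇒x≈y to x-y≈0⇒x≈y)

        X^M≈𝟙 : X^ M ≈[ u ] 𝟙
        X^M≈𝟙 .at n = trans (act-X^ M u n) (per n)

        X^≈^ : ∀ k → X^ k ≈[ u ] X ^ k
        X^≈^ zero    = R.refl
        X^≈^ (suc k) = R.*-congˡ (X^≈^ k)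

        𝟙^n≈𝟙 : ∀ n → 𝟙 ^ n ≈[ u ] 𝟙
        𝟙^n≈𝟙 zero    = R.refl
        𝟙^n≈𝟙 (suc n) = R.trans (R.*-identityˡ _) (𝟙^n≈𝟙 n)

        act-× : ∀ k a n → act (SemiringMult._×_ R.semiring k a) u n ≈ k × act a u n
        act-× zero    a n = refl
        act-× (suc k) a n = ∙-congˡ (act-× k a n)

        ^q-distrib-⊕ : ∀ a b → (a ⊕ b) ^ q ≈[ u ] a ^ q ⊕ b ^ q
        ^q-distrib-⊕ a b = ≡.subst (λ n → (a ⊕ b) ^ n ≈[ u ] a ^ n ⊕ b ^ n) (≡.sym q≡p^m)
          (Frobenius.^p^m-distrib-+ R.commutativeSemiring p-prime
            (λ c → agree λ n → trans (act-× (suc p-1) c n) (char (act c u n))) m a b)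

        -- Raising to the power `q` is multiplicative, and additive by Frobenius, so it suffices
        -- that it fixes the generators; for `X` this follows from `X^M≈𝟙`.
        ^q≈id : ∀ a → a ^ q ≈[ u ] a
        ^q≈id 𝟘       = R.zeroˡ (𝟘 ^ M)
        ^q≈id 𝟙       = 𝟙^n≈𝟙 q
        ^q≈id X       = R.trans (R.*-congˡ (R.trans (R.sym (X^≈^ M)) X^M≈𝟙)) (R.*-identityʳ X)
        ^q≈id (a ⊕ b) = R.trans (^q-distrib-⊕ a b) (R.+-cong (^q≈id a) (^q≈id b))
        ^q≈id (a ⊗ b) = R.trans (^-distrib-* a b q) (R.*-cong (^q≈id a) (^q≈id b))

        -- Applying `a ^ M` to `act a u` amounts to applying `a ^ q` to `u`, which gives `act a u`
        -- back. So `a ^ M-1` becomes an inverse.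
        refine-invert : ∀ a → Invertible (act a u) a
        -- A relation modulo `act a u` unfolds to the same relation multiplied by `a`, modulo `u`;
        -- unwrapping with `at` and rewrapping with `agree` converts between the two.
        refine-invert a = a ^ M-1 , agree (aᴹa≈a .at)
          where
          aᴹa≈a : (a ⊗ a ^ M-1) ⊗ a ≈[ u ] a
          aᴹa≈a = R.trans (R.*-comm _ _) (^q≈id a)

        -- If `a ^ M = 1`, then `a` is already invertible. Otherwise `u` is multiplied by
        -- `c = 1 - a ^ M`: the result is nonzero because `a ^ M ≠ 1`, and `a c = a - a ^ q = 0`.
        refine-zeroOrUnit-at : ¬ (𝟙 ≈[ u ] 𝟘) → ∀ a →
          ∃ λ w → Refines u w ∧ Periodic w ∧ ¬ (𝟙 ≈[ w ] 𝟘) ∧ ZeroOrUnit w a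
        refine-zeroOrUnit-at 1≉0 a with ≈-dec per (a ^ M) 𝟙
        ... | yes aᴹ≈1 = u , id , per , 1≉0 , inj₂ (a ^ M-1 , aᴹ≈1)
        ... | no  aᴹ≉1 = act c u , ≈-act c , act-periodic c per ,
            (λ 1≈0 → aᴹ≉1 (R.sym (x-y≈0⇒x≈y _ _ (agree (1≈0 .at))))) ,
            inj₁ (agree (ac≈0 .at))
          where
          c = 𝟙 ⊕ ⊖ (a ^ M)
          ac≈0 : a ⊗ c ≈[ u ] 𝟘
          ac≈0 = MonicPolynomials.x*y≈x⇒x*[1-y]≈0 (cyclicRing u) (^q≈id a)

      refine-zeroOrUnits : ∀ {u} → Periodic u → ¬ (𝟙 ≈[ u ] 𝟘) → ∀ as →
        ∃ λ w → Refines u w ∧ Periodic w ∧ ¬ (𝟙 ≈[ w ] 𝟘) ∧ All (ZeroOrUnit w) as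
      refine-zeroOrUnits {u} per 1≉0 [] = u , id , per , 1≉0 , []
      refine-zeroOrUnits per 1≉0 (a ∷ as) with refine-zeroOrUnits per 1≉0 as
      ... | v , u⊒v , per-v , 1≉0-v , zus with refine-zeroOrUnit-at per-v 1≉0-v a
      ... | w , v⊒w , per-w , 1≉0-w , zu =
        w , v⊒w ∘ u⊒v , per-w , 1≉0-w , zu ∷ All.map (refine-zeroOrUnit v⊒w) zus

      -- Multiplying `u` by all operators of the list might annihilate it; that this does not happen
      -- to `δ` in the application is the content of `sieve-0`.
      refine-units : ∀ {u} → Periodic u → ∀ as → Periodic (List.foldr act u as) ∧ All (Invertible (List.foldr act u as)) as
      refine-units per [] = per , []
      refine-units {u} per (a ∷ as) with refine-units per as
      ... | per′ , units = act-periodic a per′ , refine-invert per′ a ∷ All.map (refine-unit (≈-act a)) units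

-- Primitive roots and the points they generate.

primeDivisor : ∀ n → 1 < n → ∃ λ l → Prime l ∧ l ∣ n
primeDivisor n 1<n with factorise n {{>-nonZero (ℕ.<-trans z<s 1<n)}}
... | record { factors = []    ; isFactorisation = n≡1 } = contradiction (≡.sym n≡1) (ℕ.<⇒≢ 1<n)
... | record { factors = l ∷ ls ; isFactorisation = n≡l*_ ; factorsPrime = prime-l ∷ _ } =
  l , prime-l , divides (List.foldr ℕ._*_ 1 ls) (≡.trans n≡l*_ (ℕ.*-comm l _))

module _ (K : CommutativeRing 0ℓ 0ℓ) where
  open CommutativeRing K hiding (zero)

  -- `pow-free` expresses order exactly `M` in a form suited to zero divisors: for `0 < d < M`, the
  -- element `1 - pow d` is regular and not merely nonzero.
  record PrimitiveRoot (M : ℕ) : Set where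
    field
      pow       : ℕ → Carrier
      pow-0     : pow 0 ≈ 1#
      pow-+     : ∀ m n → pow (m ℕ.+ n) ≈ pow m * pow n
      pow-M     : pow M ≈ 1#
      pow-free  : ∀ d → 0 < d → d < M → ∀ z → pow d * z ≈ z → z ≈ 0#

    point : Fin (suc M) → Carrier
    point zero    = 0#
    point (suc i) = pow (toℕ i)

module PowersFixing (K : CommutativeRing 0ℓ 0ℓ) where
  open CommutativeRing K hiding (zero)
  open MonicPolynomials K using (Unit)
  open RingProperties ring using ([y-z]x≈yx-zx)
  open GroupProperties +-group using () renaming (x∙y⁻¹≈ε⇒x≈y to x-y≈0⇒x≈y; x≈y⇒x∙y⁻¹≈ε to x≈y⇒x-y≈0) public
  open SetoidReasoning setoid

  unit-cancel : ∀ {x z} → Unit x → x * z ≈ 0# → z ≈ 0#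
  unit-cancel {x} {z} (y , xy≈1) xz≈0 = begin
    z              ≈⟨ *-identityˡ z ⟨
    1# * z         ≈⟨ *-congʳ (trans (*-comm y x) xy≈1) ⟨
    (y * x) * z    ≈⟨ *-assoc y x z ⟩
    y * (x * z)    ≈⟨ *-congˡ xz≈0 ⟩
    y * 0#         ≈⟨ zeroʳ y ⟩
    0#             ∎

  module _ (pow : ℕ → Carrier) (pow-0 : pow 0 ≈ 1#) (pow-+ : ∀ m n → pow (m ℕ.+ n) ≈ pow m * pow n) where

    Fixes : Carrier → ℕ → Set
    Fixes z s = pow s * z ≈ z

    pow-+-* : ∀ a b z → pow (a ℕ.+ b) * z ≈ pow a * (pow b * z)
    pow-+-* a b z = trans (*-congʳ (pow-+ a b)) (*-assoc _ _ _)

    fixes-+ : ∀ {z} a {b} → Fixes z a → Fixes z b → Fixes z (a ℕ.+ b)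
    fixes-+ a fa fb = trans (pow-+-* a _ _) (trans (*-congˡ fb) fa)

    fixes-∸ : ∀ {z} a {b} → Fixes z (a ℕ.+ b) → Fixes z b → Fixes z a
    fixes-∸ a {b} fab fb = trans (*-congˡ (sym fb)) (trans (sym (pow-+-* a b _)) fab)

    fixes-* : ∀ {z} c {a} → Fixes z a → Fixes z (c ℕ.* a)
    fixes-* zero    fa = trans (*-congʳ pow-0) (*-identityˡ _)
    fixes-* (suc c) fa = fixes-+ _ fa (fixes-* c fa)

    -- The exponents fixing `z` are closed under sums, differences and multiples, so Bézout applies;
    -- over the natural numbers the identity has two forms, according to which multiple is larger.
    fixes-gcd : ∀ {z} a b → Fixes z a → Fixes z b → Fixes z (gcd a b)
    fixes-gcd {z} a b fa fb with Bézout.identity (gcd-GCD a b)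
    ... | Bézout.+- x y g+yb≡xa = fixes-∸ _ (≡.subst (Fixes z) (≡.sym g+yb≡xa) (fixes-* x fa)) (fixes-* y fb)
    ... | Bézout.-+ x y g+xa≡yb = fixes-∸ _ (≡.subst (Fixes z) (≡.sym g+xa≡yb) (fixes-* y fb)) (fixes-* x fa)

    -- With `g = gcd d M < M`, the quotient `M / g` has a prime divisor `l`. Then `g` divides
    -- `M / l`, so `pow (M / l)` fixes `z`, and the unit `1 - pow (M / l)` annihilates it.
    fixes-pow⇒≈0 : ∀ {M} → pow M ≈ 1# →
      (∀ l c → Prime l → M ≡ c ℕ.* l → Unit (1# - pow c)) →
      ∀ d → 0 < d → d < M → ∀ z → Fixes z d → z ≈ 0#
    fixes-pow⇒≈0 {M} pow-M units d 0<d d<M z fd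
      with gcd[m,n]∣n d M
    ... | divides c M≡c*g with primeDivisor c 1<c
      where
      g = gcd d M
      1<c : 1 < c
      1<c = ℕ.*-cancelʳ-< g 1 c (ℕ.≤-<-trans
        (≡.subst (ℕ._≤ d) (≡.sym (ℕ.*-identityˡ g)) (∣⇒≤ {{>-nonZero 0<d}} (gcd[m,n]∣m d M)))
        (≡.subst (d <_) M≡c*g d<M))
    ... | l , prime-l , divides b c≡b*l = unit-cancel (units l (b ℕ.* g) prime-l M≡bg*l) (begin
      (1# - pow (b ℕ.* g)) * z          ≈⟨ [y-z]x≈yx-zx z 1# _ ⟩
      1# * z - pow (b ℕ.* g) * z        ≈⟨ x≈y⇒x-y≈0 (trans (*-identityˡ z) (sym (fixes-* b (fixes-gcd d M fd fM)))) ⟩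
      0#                                ∎)
      where
      g = gcd d M
      fM : Fixes z M
      fM = trans (*-congʳ pow-M) (*-identityˡ z)
      M≡bg*l : M ≡ b ℕ.* g ℕ.* l
      M≡bg*l = ≡.trans M≡c*g (≡.trans (≡.cong (ℕ._* g) c≡b*l)
        (CommutativeSemigroupProperties.xy∙z≈xz∙y ℕ.*-commutativeSemigroup b l g))

module Points {K : CommutativeRing 0ℓ 0ℓ} {M : ℕ} (root : PrimitiveRoot K M) where
  open CommutativeRing K hiding (zero)
  open PrimitiveRoot root
  open MonicPolynomials K
  open PowersFixing K
  open Exp commutativeSemiring using (_^_)
  open RingProperties ring using ([y-z]x≈yx-zx)
  open CMSum *-commutativeMonoid using () renaming (sum to product)
  open SetoidReasoning setoid

  pow-cancel : ∀ {i} → i ℕ.≤ M → Regular (pow i)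
  pow-cancel {i} i≤M z = unit-cancel (pow (M ∸ i) , (begin
    pow i * pow (M ∸ i)   ≈⟨ pow-+ i (M ∸ i) ⟨
    pow (i ℕ.+ (M ∸ i))   ≡⟨ ≡.cong pow (ℕ.m+[n∸m]≡n i≤M) ⟩
    pow M                 ≈⟨ pow-M ⟩
    1#                    ∎))

  -- The assumption says that `pow (j ∸ i)` fixes `pow i * z`, which therefore vanishes; `pow i` is
  -- then cancelled.
  pow-separated : ∀ {i j} → i < j → j < M → ∀ z → pow i * z ≈ pow j * z → z ≈ 0#
  pow-separated {i} {j} i<j j<M z iz≈jz = pow-cancel (ℕ.<⇒≤ (ℕ.<-trans i<j j<M)) z
    (pow-free (j ∸ i) (ℕ.m<n⇒0<n∸m i<j) (ℕ.≤-<-trans (ℕ.m∸n≤m j i) j<M) (pow i * z) (begin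
      pow (j ∸ i) * (pow i * z)   ≈⟨ *-assoc _ _ _ ⟨
      (pow (j ∸ i) * pow i) * z   ≈⟨ *-congʳ (pow-+ (j ∸ i) i) ⟨
      pow (j ∸ i ℕ.+ i) * z       ≡⟨ ≡.cong (λ k → pow k * z) (ℕ.m∸n+n≡m (ℕ.<⇒≤ i<j)) ⟩
      pow j * z                   ≈⟨ iz≈jz ⟨
      pow i * z                   ∎))

  points-separated : ∀ i j → i ≢ j → ∀ z → point i * z ≈ point j * z → z ≈ 0#
  points-separated zero    zero    0≢0 z _ = contradiction ≡.refl 0≢0
  points-separated zero    (suc j) _ z 0z≈jz = pow-cancel (ℕ.<⇒≤ (toℕ<n j)) z (trans (sym 0z≈jz) (zeroˡ z))
  points-separated (suc i) zero    _ z iz≈0z = pow-cancel (ℕ.<⇒≤ (toℕ<n i)) z (trans iz≈0z (zeroˡ z))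
  points-separated (suc i) (suc j) i≢j z iz≈jz with ℕ.<-cmp (toℕ i) (toℕ j)
  ... | tri< i<j _ _ = pow-separated i<j (toℕ<n j) z iz≈jz
  ... | tri≈ _ i≡j _ = contradiction (≡.cong suc (toℕ-injective i≡j)) i≢j
  ... | tri> _ _ j<i = pow-separated j<i (toℕ<n i) z (sym iz≈jz)

  points-regular : ∀ i j → i ≢ j → Regular (point i - point j)
  points-regular i j i≢j z [i-j]z≈0 = points-separated i j i≢j z
    (x-y≈0⇒x≈y _ _ (trans (sym ([y-z]x≈yx-zx z (point i) (point j))) [i-j]z≈0))

  module _ (1≉0 : ¬ (1# ≈ 0#)) (^q≈id : ∀ y → y ^ suc M ≈ y) where

    -- The Horner form is `y * (y * y ^ M′ - 1) + 0`. Positivity of `M` keeps the term `- y` apart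
    -- from the leading one.
    y^q-y-monic : ∀ {M′} → M ≡ suc M′ → Monic (suc M) (λ y → y ^ suc M - y)
    y^q-y-monic {M′} ≡.refl = step 0# (step (- 1#) (^-monic M′) (λ _ → refl)) λ y → begin
      y * (y * y ^ M′) - y                ≈⟨ +-congˡ (-‿cong (*-identityʳ y)) ⟨
      y * (y * y ^ M′) - y * 1#           ≈⟨ RingProperties.x[y-z]≈xy-xz ring y _ 1# ⟨
      y * (y * y ^ M′ - 1#)               ≈⟨ +-identityʳ _ ⟨
      y * (y * y ^ M′ - 1#) + 0#          ∎

    -- The product of all `y - point k` is `y ^ q - y = 0`; were every factor invertible, it would
    -- be a unit, against `1≉0`.
    zeroOrUnits⇒point : ∀ {M′} → M ≡ suc M′ → ∀ y →
      (∀ k → y - point k ≈ 0# ⊎ Unit (y - point k)) → ∃ λ k → y ≈ point k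
    zeroOrUnits⇒point M≡1+M′ y zeroOrUnit with product-unit (λ k → y - point k) zeroOrUnit
    ... | inj₁ (k , y-k≈0) = k , x-y≈0⇒x≈y y (point k) y-k≈0
    ... | inj₂ (z , Pz≈1)  = contradiction 1≈0 1≉0
      where
      1≈0 : 1# ≈ 0#
      1≈0 = begin
        1#                                    ≈⟨ Pz≈1 ⟨
        product (λ k → y - point k) * z       ≈⟨ *-congʳ (monic≈product (y^q-y-monic M≡1+M′) point
          points-regular (λ i → x≈y⇒x-y≈0 (^q≈id (point i))) y) ⟨
        (y ^ suc M - y) * z                   ≈⟨ *-congʳ (x≈y⇒x-y≈0 (^q≈id y)) ⟩
        0# * z                                ≈⟨ zeroˡ z ⟩
        0#                                    ∎

  point-injective : ¬ (1# ≈ 0#) → ∀ i j → point i ≈ point j → i ≡ j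
  point-injective 1≉0 i j ti≈tj with i ≟ j
  ... | yes i≡j = i≡j
  ... | no  i≢j = contradiction (points-separated i j i≢j 1# (*-congʳ ti≈tj)) 1≉0

  pow-*M : ∀ c → pow (c ℕ.* M) ≈ 1#
  pow-*M zero    = pow-0
  pow-*M (suc c) = trans (pow-+ M (c ℕ.* M)) (trans (*-cong pow-M (pow-*M c)) (*-identityˡ 1#))

  module _ {{_ : NonZero M}} where

    pow-% : ∀ n → pow n ≈ pow (n % M)
    pow-% n = begin
      pow n                                 ≡⟨ ≡.cong pow (m≡m%n+[m/n]*n n M) ⟩
      pow (n % M ℕ.+ n / M ℕ.* M)           ≈⟨ pow-+ (n % M) _ ⟩
      pow (n % M) * pow (n / M ℕ.* M)       ≈⟨ *-congˡ (pow-*M (n / M)) ⟩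
      pow (n % M) * 1#                      ≈⟨ *-identityʳ _ ⟩
      pow (n % M)                           ∎

    index : ℕ → Fin (suc M)
    index n = suc (fromℕ< (m%n<n n M))

    pow≈point : ∀ n → pow n ≈ point (index n)
    pow≈point n = trans (pow-% n) (reflexive (≡.cong pow (≡.sym (toℕ-fromℕ< (m%n<n n M)))))

-- The field with `M + 1` elements, described through a primitive root: each nonzero element is a
-- power of it, hence invertible.
record CyclicField (M : ℕ) : Set₁ where
  field
    ring    : CommutativeRing 0ℓ 0ℓ
    root    : PrimitiveRoot ring M
  open CommutativeRing ring using (_≈_; 0#; 1#)
  open PrimitiveRoot root using (point)
  field
    1≉0              : ¬ (1# ≈ 0#)
    point-surjective : ∀ y → ∃ λ k → y ≈ point k

-- Prime divisors of `M` and their cofactors.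

PrimeDivisor : ℕ → Set
PrimeDivisor M = ∃ λ l → Prime l ∧ l ∣ M

cofactor : ∀ {M} → PrimeDivisor M → ℕ
cofactor (_ , _ , divides c _) = c

radical : ∀ {M} → List (PrimeDivisor M) → ℕ
radical []       = 1
radical (d ∷ ds) = proj₁ d ℕ.* radical ds

primeDivisorsBelow : ∀ M (n : ℕ) → List (PrimeDivisor M)
primeDivisorsBelow M zero    = []
primeDivisorsBelow M (suc n) with prime? n ×-dec (n ∣? M)
... | yes (prime-n , n∣M) = (n , prime-n , n∣M) ∷ primeDivisorsBelow M n
... | no  _               = primeDivisorsBelow M n

-- The member found may carry other proofs of primality and divisibility than the given ones, so the
-- conclusion speaks of its cofactor only.
∈-primeDivisorsBelow : ∀ {M l c} → Prime l → M ≡ c ℕ.* l → ∀ n → l < n →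
  ∃ λ d → d ∈ primeDivisorsBelow M n ∧ cofactor d ≡ c
∈-primeDivisorsBelow {M} {l} {c} prime-l M≡c*l (suc n) l<1+n with prime? n ×-dec (n ∣? M) | ℕ.m<1+n⇒m<n∨m≡n l<1+n
... | yes (_ , divides c′ M≡c′*l) | inj₂ ≡.refl = _ , here ≡.refl ,
    ℕ.*-cancelʳ-≡ c′ c l {{prime⇒nonZero prime-l}} (≡.trans (≡.sym M≡c′*l) M≡c*l)
... | no  ¬p | inj₂ ≡.refl = contradiction (prime-l , divides c M≡c*l) ¬p
... | yes _  | inj₁ l<n = let d , d∈ , eq = ∈-primeDivisorsBelow prime-l M≡c*l n l<n in d , there d∈ , eq
... | no  _  | inj₁ l<n = ∈-primeDivisorsBelow prime-l M≡c*l n l<n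

-- The radical is a product of primes below `n ≤ l`, and `l` divides none of them.
prime∤radical : ∀ {M l} → Prime l → ∀ n → n ℕ.≤ l → ¬ (l ∣ radical (primeDivisorsBelow M n))
prime∤radical prime-l zero _ l∣1 = ¬prime[1] (≡.subst Prime (∣1⇒≡1 l∣1) prime-l)
prime∤radical {M} {l} prime-l (suc n) n<l l∣rad with prime? n ×-dec (n ∣? M)
... | no _ = prime∤radical {M} prime-l n (ℕ.<⇒≤ n<l) l∣rad
... | yes (prime-n , _) with euclidsLemma n _ prime-l l∣rad
... | inj₁ l∣n = contradiction (∣⇒≤ {{prime⇒nonZero prime-n}} l∣n) (ℕ.<⇒≱ n<l)
... | inj₂ l∣rad′ = prime∤radical {M} prime-l n (ℕ.<⇒≤ n<l) l∣rad′

-- Construction of the field from periodic sequences.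

module Construction
  (A : CommutativeMonoid 0ℓ 0ℓ) (_≈?_ : Decidable (CommutativeMonoid._≈_ A))
  {p-1 : ℕ} (p-prime : Prime (suc p-1)) (char : HasExponent A (suc p-1))
  {M-1 m : ℕ} (q≡p^m : suc (suc M-1) ≡ suc p-1 ℕ.^ m)
  (e : CommutativeMonoid.Carrier A) (e≉ε : ¬ CommutativeMonoid._≈_ A e (CommutativeMonoid.ε A)) where

  open CommutativeMonoid A
  open ShiftOperators A p-1 char
  open Periodicity M-1
  open Refinement _≈?_ p-prime m q≡p^m
  open CMMult A using (_×_)
  open SetoidReasoning setoid

  δ : Sequence
  δ n = if does (M ∣? n) then e else ε

  δ-∣ : ∀ {n} → M ∣ n → δ n ≡ e
  δ-∣ {n} M∣n = ≡.cong (if_then e else ε) (dec-true (M ∣? n) M∣n)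

  δ-∤ : ∀ {n} → ¬ (M ∣ n) → δ n ≡ ε
  δ-∤ {n} M∤n = ≡.cong (if_then e else ε) (dec-false (M ∣? n) M∤n)

  δ-periodic : Periodic δ
  δ-periodic n with M ∣? n
  ... | yes M∣n = reflexive (≡.trans (δ-∣ (∣m∣n⇒∣m+n ℕ.∣-refl M∣n)) (≡.sym (δ-∣ M∣n)))
  ... | no  M∤n = reflexive (≡.trans (δ-∤ (λ M∣M+n → M∤n (∣m+n∣m⇒∣n M∣M+n ℕ.∣-refl))) (≡.sym (δ-∤ M∤n)))

  1-X^ : PrimeDivisor M → Operator
  1-X^ d = 𝟙 ⊕ ⊖ (X^ cofactor d)

  sieve : List (PrimeDivisor M) → Sequence
  sieve ds = List.foldr act δ (List.map 1-X^ ds)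

  ×-ε : ∀ k {a} → a ≈ ε → k × a ≈ ε
  ×-ε zero    a≈ε = refl
  ×-ε (suc k) a≈ε = trans (∙-cong a≈ε (×-ε k a≈ε)) (identityˡ ε)

  act-1-X^ : ∀ d u n → u (cofactor d ℕ.+ n) ≈ ε → act (1-X^ d) u n ≈ u n
  act-1-X^ d u n u≈ε = trans (∙-congˡ (begin
    act (⊖ (X^ c)) u n         ≈⟨ act-×ᵒ p-1 (X^ c) u n ⟩
    p-1 × act (X^ c) u n       ≈⟨ ×-ε p-1 (trans (act-X^ c u n) u≈ε) ⟩
    ε                          ∎)) (identityʳ _)
    where c = cofactor d

  -- The factor for `l` adds a multiple of a translate by `c = M / l`. Since
  -- `l (c + n) r = M r + n (l r)`, divisibility of `(c + n) r` by `M` implies that of `n (l r)`, so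
  -- the translate obeys the new bound on the support as well.
  sieve-support : ∀ ds n → ¬ (M ∣ n ℕ.* radical ds) → sieve ds n ≈ ε
  sieve-support [] n M∤n = reflexive (δ-∤ (M∤n ∘ ≡.subst (M ∣_) (≡.sym (ℕ.*-identityʳ n))))
  sieve-support (d@(l , _ , divides c M≡c*l) ∷ ds) n M∤nlr = trans
    (act-1-X^ d (sieve ds) n (sieve-support ds (c ℕ.+ n) M∤[c+n]r))
    (sieve-support ds n M∤nr)
    where
    r = radical ds
    nlr≡l[nr] : n ℕ.* (l ℕ.* r) ≡ l ℕ.* (n ℕ.* r)
    nlr≡l[nr] = CommutativeSemigroupProperties.x∙yz≈y∙xz ℕ.*-commutativeSemigroup n l r
    M∤nr : ¬ (M ∣ n ℕ.* r)
    M∤nr M∣nr = M∤nlr (≡.subst (M ∣_) (≡.sym nlr≡l[nr]) (ℕ.∣n⇒∣m*n l M∣nr))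
    l[c+n]r≡Mr+nlr : l ℕ.* ((c ℕ.+ n) ℕ.* r) ≡ M ℕ.* r ℕ.+ n ℕ.* (l ℕ.* r)
    l[c+n]r≡Mr+nlr = ≡.trans (≡.cong (l ℕ.*_) (ℕ.*-distribʳ-+ r c n))
      (≡.trans (ℕ.*-distribˡ-+ l (c ℕ.* r) (n ℕ.* r))
      (≡.cong₂ ℕ._+_
        (≡.trans (≡.sym (ℕ.*-assoc l c r)) (≡.cong (ℕ._* r) (≡.trans (ℕ.*-comm l c) (≡.sym M≡c*l))))
        (≡.sym nlr≡l[nr])))
    M∤[c+n]r : ¬ (M ∣ (c ℕ.+ n) ℕ.* r)
    M∤[c+n]r M∣[c+n]r = M∤nlr (∣m+n∣m⇒∣n
      (≡.subst (M ∣_) l[c+n]r≡Mr+nlr (ℕ.∣n⇒∣m*n l M∣[c+n]r)) (ℕ.∣m⇒∣m*n r ℕ.∣-refl))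

  -- The factor for a prime `n` does not change the value at 0, because the sequence sieved by the
  -- smaller primes vanishes at `c = M / n`: if `M = c n` divided `c * radical ds`, then `n` would
  -- divide a product of smaller primes.
  sieve-0 : ∀ n → sieve (primeDivisorsBelow M n) 0 ≈ e
  sieve-0 zero = reflexive (δ-∣ (M ℕ.∣0))
  sieve-0 (suc n) with prime? n ×-dec (n ∣? M)
  ... | no _ = sieve-0 n
  ... | yes (prime-n , n∣M@(divides c M≡c*n)) = trans
    (act-1-X^ (n , prime-n , n∣M) (sieve ds) 0 (sieve-support ds (c ℕ.+ 0) M∤cr))
    (sieve-0 n)
    where
    ds = primeDivisorsBelow M n
    c≢0 : c ≢ 0
    c≢0 ≡.refl = ℕ.1+n≢0 M≡c*n
    M∤cr : ¬ (M ∣ (c ℕ.+ 0) ℕ.* radical ds)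
    M∤cr M∣cr = prime∤radical {M} prime-n n ℕ.≤-refl
      (ℕ.*-cancelˡ-∣ c {{ℕ.≢-nonZero c≢0}}
        (≡.subst₂ _∣_ M≡c*n (≡.cong (ℕ._* radical ds) (ℕ.+-identityʳ c)) M∣cr))

  divisors : List (PrimeDivisor M)
  divisors = primeDivisorsBelow M (suc M)

  u₁ : Sequence
  u₁ = sieve divisors

  1≉0-u₁ : ¬ (𝟙 ≈[ u₁ ] 𝟘)
  1≉0-u₁ 1≈0 = e≉ε (trans (sym (sieve-0 (suc M))) (1≈0 .at 0))

  -- Defined before `u` is chosen, because `differences` must list in advance what the refinement
  -- has to settle; `point≡` later identifies these operators with the points of `root`.
  point : Fin q → Operator
  point zero    = 𝟘
  point (suc i) = X^ toℕ i

  x+y-z : Fin q ∧ Fin q → Fin q → Operator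
  x+y-z (i , j) k = (point i ⊕ point j) ⊕ ⊖ point k

  differences : List Operator
  differences = List.cartesianProductWith x+y-z
    (List.cartesianProductWith _,_ (List.allFin q) (List.allFin q)) (List.allFin q)

  difference∈ : ∀ i j k → x+y-z (i , j) k ∈ differences
  difference∈ i j k = ∈-cartesianProductWith⁺ x+y-z
    (∈-cartesianProductWith⁺ _,_ (∈-allFin i) (∈-allFin j)) (∈-allFin k)

  module Field {u : Sequence} (u₁⊒u : Refines u₁ u) (per : Periodic u) (1≉0 : ¬ (𝟙 ≈[ u ] 𝟘))
    (units : All (Invertible u₁) (List.map 1-X^ divisors))
    (zeroOrUnits : All (ZeroOrUnit u) differences) where

    K : CommutativeRing 0ℓ 0ℓ
    K = cyclicRing u

    private
      module K = CommutativeRing K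

    X^-+ : ∀ i j → X^ (i ℕ.+ j) ≈[ u ] (X^ i) ⊗ (X^ j)
    X^-+ zero    j = K.sym (K.*-identityˡ _)
    X^-+ (suc i) j = K.trans (K.*-congˡ (X^-+ i j)) (K.sym (K.*-assoc X (X^ i) (X^ j)))

    unit-1-X^ : ∀ l c → Prime l → M ≡ c ℕ.* l → Invertible u (𝟙 ⊕ ⊖ (X^ c))
    unit-1-X^ l c prime-l M≡c*l
      with ∈-primeDivisorsBelow prime-l M≡c*l (suc M)
             (ℕ.s≤s (∣⇒≤ (divides c M≡c*l)))
    ... | d , d∈ , ≡.refl = refine-unit u₁⊒u (All.lookup units (∈-map⁺ 1-X^ d∈))

    root : PrimitiveRoot K M
    root = record
      { pow      = X^_
      ; pow-0    = K.refl
      ; pow-+    = X^-+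
      ; pow-M    = X^M≈𝟙 per
      ; pow-free = PowersFixing.fixes-pow⇒≈0 K X^_ K.refl X^-+ (X^M≈𝟙 per) unit-1-X^
      }

    open Points root using (zeroOrUnits⇒point; pow≈point; index)

    point≡ : ∀ k → PrimitiveRoot.point root k ≡ point k
    point≡ zero    = ≡.refl
    point≡ (suc k) = ≡.refl

    IsPoint : Operator → Set
    IsPoint y = ∃ λ k → y ≈[ u ] PrimitiveRoot.point root k

    ⊕-isPoint : ∀ {a b} → IsPoint a → IsPoint b → IsPoint (a ⊕ b)
    ⊕-isPoint (i , a≈i) (j , b≈j)
      with zeroOrUnits⇒point 1≉0 (^q≈id per) ≡.refl (point i ⊕ point j)
             (λ k → ≡.subst (λ t → ZeroOrUnit u ((point i ⊕ point j) ⊕ ⊖ t)) (≡.sym (point≡ k))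
               (All.lookup zeroOrUnits (difference∈ i j k)))
    ... | k , i+j≈k = k , K.trans (K.+-cong
            (K.trans a≈i (K.reflexive (point≡ i))) (K.trans b≈j (K.reflexive (point≡ j)))) i+j≈k

    ⊗-isPoint : ∀ {a b} → IsPoint a → IsPoint b → IsPoint (a ⊗ b)
    ⊗-isPoint {b = b} (zero , a≈0) _ = zero , K.trans (K.*-congʳ a≈0) (K.zeroˡ b)
    ⊗-isPoint {a} (suc i , _) (zero , b≈0) = zero , K.trans (K.*-congˡ b≈0) (K.zeroʳ a)
    ⊗-isPoint (suc i , a≈) (suc j , b≈) = index (toℕ i ℕ.+ toℕ j) ,
      K.trans (K.*-cong a≈ b≈) (K.trans (K.sym (X^-+ (toℕ i) (toℕ j))) (pow≈point (toℕ i ℕ.+ toℕ j)))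

    isPoint : ∀ y → IsPoint y
    isPoint 𝟘       = zero , K.refl
    isPoint 𝟙       = index 0 , pow≈point 0
    isPoint X       = index 1 , K.trans (K.sym (K.*-identityʳ X)) (pow≈point 1)
    isPoint (a ⊕ b) = ⊕-isPoint (isPoint a) (isPoint b)
    isPoint (a ⊗ b) = ⊗-isPoint (isPoint a) (isPoint b)

    cyclicField : CyclicField M
    cyclicField = record { ring = K ; root = root ; 1≉0 = 1≉0 ; point-surjective = isPoint }

  cyclicField : CyclicField M
  cyclicField =
    let per₁ , units = refine-units δ-periodic (List.map 1-X^ divisors)
        u , u₁⊒u , per , 1≉0 , zeroOrUnits = refine-zeroOrUnits per₁ 1≉0-u₁ differences
    in Field.cyclicField {u} u₁⊒u per 1≉0 units zeroOrUnits

-- The coefficients: integers modulo `n`.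

module _ (n : ℕ) .{{_ : NonZero n}} where

  +-mod-commutativeMonoid : CommutativeMonoid 0ℓ 0ℓ
  +-mod-commutativeMonoid = record
    { Carrier = ℕ
    ; _≈_     = λ x y → x % n ≡ y % n
    ; _∙_     = ℕ._+_
    ; ε       = 0
    ; isCommutativeMonoid = record
      { isMonoid = record
        { isSemigroup = record
          { isMagma = record
            { isEquivalence = record { refl = ≡.refl ; sym = ≡.sym ; trans = ≡.trans }
            ; ∙-cong = λ {x} {y} {u} {v} x≡y u≡v → ≡.trans (%-distribˡ-+ x u n)
                (≡.trans (≡.cong₂ (λ s t → (s ℕ.+ t) % n) x≡y u≡v) (≡.sym (%-distribˡ-+ y v n)))
            }
          ; assoc = λ x y z → ≡.cong (_% n) (ℕ.+-assoc x y z)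
          }
        ; identity = (λ x → ≡.refl) , (λ x → ≡.cong (_% n) (ℕ.+-identityʳ x))
        }
      ; comm = λ x y → ≡.cong (_% n) (ℕ.+-comm x y)
      }
    }

  open CMMult +-mod-commutativeMonoid using (_×_)

  ×≡* : ∀ k x → k × x ≡ k ℕ.* x
  ×≡* zero    x = ≡.refl
  ×≡* (suc k) x = ≡.cong (x ℕ.+_) (×≡* k x)

  n×x≡0 : HasExponent +-mod-commutativeMonoid n
  n×x≡0 x = ≡.trans (≡.cong (_% n) (≡.trans (×≡* n x) (ℕ.*-comm n x)))
    (≡.trans (m*n%n≡0 x n) (≡.sym (m*n%n≡0 0 n)))

cyclicField-exists : ∀ {p} → Prime p → ∀ m M → 0 < M → suc M ≡ p ℕ.^ m → CyclicField M
cyclicField-exists {zero} p-prime = contradiction p-prime ¬prime[0]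
cyclicField-exists {suc zero} p-prime = contradiction p-prime ¬prime[1]
-- With `p` visibly at least 2, `1 % p` computes to `1`; so `1` serves as the nonzero coefficient
-- `e`, and `λ ()` refutes its vanishing.
cyclicField-exists {p@(suc (suc _))} p-prime m (suc _) _ q≡p^m =
  Construction.cyclicField (+-mod-commutativeMonoid p) (λ x y → x % p ℕ.≟ y % p)
    p-prime (n×x≡0 p) {m = m} q≡p^m 1 (λ ())

-- Sums over residue classes.

module PeriodicSums (C : CommutativeMonoid 0ℓ 0ℓ) where
  open CommutativeMonoid C
  open CMSum C using (sum; sum-cong-≋; sum-cong-≗; sum-init-last; sum-replicate-zero)
  open SetoidReasoning setoid

  sumTo : ℕ → (ℕ → Carrier) → Carrier
  sumTo n f = sum {n} (f ∘ toℕ)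

  sumTo-last : ∀ n (f : ℕ → Carrier) → sumTo (suc n) f ≈ sumTo n f ∙ f n
  sumTo-last n f = trans (sum-init-last (f ∘ toℕ))
    (reflexive (≡.cong₂ _∙_ (sum-cong-≗ {n} (≡.cong f ∘ toℕ-inject₁)) (≡.cong f (toℕ-fromℕ n))))

  sumTo-+ : ∀ m n (f : ℕ → Carrier) → sumTo (m ℕ.+ n) f ≈ sumTo m f ∙ sumTo n (λ i → f (m ℕ.+ i))
  sumTo-+ zero    n f = sym (identityˡ _)
  sumTo-+ (suc m) n f = trans (∙-congˡ (sumTo-+ m n (f ∘ suc))) (sym (assoc _ _ _))

  sumTo-single : ∀ n {a} → a < n → ∀ (f : ℕ → Carrier) → sumTo n (λ i → if does (i ℕ.≟ a) then f i else ε) ≈ f a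
  sumTo-single (suc n) {zero}  _ f = trans (∙-congˡ (sum-replicate-zero n)) (identityʳ _)
  sumTo-single (suc n) {suc a} a<n f = trans (identityˡ _) (sumTo-single n (ℕ.s<s⁻¹ a<n) (f ∘ suc))

  -- The range of length `k * d` splits into `k` stretches of length `d`, each with exactly one
  -- index of residue `a`.
  sumTo-periodic : ∀ d .{{_ : NonZero d}} {a} → a < d → ∀ k (f : ℕ → Carrier) →
    sumTo (k ℕ.* d) (λ i → if does (i % d ℕ.≟ a) then f i else ε) ≈ sumTo k (λ j → f (j ℕ.* d ℕ.+ a))
  sumTo-periodic d a<d zero f = refl
  sumTo-periodic d {a} a<d (suc k) f = trans
    (sumTo-+ d (k ℕ.* d) (λ i → if does (i % d ℕ.≟ a) then f i else ε)) (∙-cong first rest)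
    where
    first : sumTo d (λ i → if does (i % d ℕ.≟ a) then f i else ε) ≈ f a
    first = trans (sum-cong-≋ {d} λ i → reflexive
        (≡.cong (λ r → if does (r ℕ.≟ a) then f (toℕ i) else ε) (m<n⇒m%n≡m (toℕ<n i))))
      (sumTo-single d a<d f)
    rest : sumTo (k ℕ.* d) (λ i → if does ((d ℕ.+ i) % d ℕ.≟ a) then f (d ℕ.+ i) else ε) ≈
           sumTo k (λ j → f (d ℕ.+ j ℕ.* d ℕ.+ a))
    rest = begin
      sumTo (k ℕ.* d) (λ i → if does ((d ℕ.+ i) % d ℕ.≟ a) then f (d ℕ.+ i) else ε)
        ≈⟨ sum-cong-≋ {k ℕ.* d} (λ i → reflexive (≡.cong (λ r → if does (r ℕ.≟ a) then f (d ℕ.+ toℕ i) else ε)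
             (≡.trans (≡.cong (_% d) (ℕ.+-comm d (toℕ i))) ([m+n]%n≡m%n (toℕ i) d)))) ⟩
      sumTo (k ℕ.* d) (λ i → if does (i % d ℕ.≟ a) then f (d ℕ.+ i) else ε)
        ≈⟨ sumTo-periodic d a<d k (λ i → f (d ℕ.+ i)) ⟩
      sumTo k (λ j → f (d ℕ.+ (j ℕ.* d ℕ.+ a)))
        ≈⟨ sum-cong-≋ {k} (λ j → reflexive (≡.cong f (≡.sym (ℕ.+-assoc d _ a)))) ⟩
      sumTo k (λ j → f (d ℕ.+ j ℕ.* d ℕ.+ a))  ∎

-- Finite subsets, their sizes and unions.

∣p∣≤1 : ∀ {n} (p : Subset n) → (∀ {x y} → x ∈ˢ p → y ∈ˢ p → x ≡ y) → ∣ p ∣ ≤ 1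
∣p∣≤1 []           _      = z≤n
∣p∣≤1 (outside ∷ p) unique = ∣p∣≤1 p λ x∈p y∈p → suc-injective (unique (Vec.there x∈p) (Vec.there y∈p))
∣p∣≤1 {suc n} (inside ∷ p) unique =
  s≤s (ℕ.≤-reflexive (≡.trans (≡.cong ∣_∣ (Empty-unique empty)) (∣⊥∣≡0 n)))
  where
  empty : Empty p
  empty (x , x∈p) with () ← unique Vec.here (Vec.there x∈p)

∣tabulate∣≡sum : ∀ {n} (b : Fin n → Bool) →
  ∣ Vec.tabulate b ∣ ≡ CMSum.sum ℕ.+-0-commutativeMonoid (λ i → if b i then 1 else 0)
∣tabulate∣≡sum {zero}  b = ≡.refl
∣tabulate∣≡sum {suc n} b with b zero
... | true  = ≡.cong suc (∣tabulate∣≡sum (b ∘ suc))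
... | false = ∣tabulate∣≡sum (b ∘ suc)

∈⋃⁻ : ∀ {n} {x : Fin n} ps → x ∈ˢ ⋃ ps → ∃ λ p → p ∈ ps ∧ x ∈ˢ p
∈⋃⁻ []       x∈⊥ = contradiction x∈⊥ ∉⊥
∈⋃⁻ (p ∷ ps) x∈ with x∈p∪q⁻ p (⋃ ps) x∈
... | inj₁ x∈p  = p , here ≡.refl , x∈p
... | inj₂ x∈ps = let p′ , p′∈ps , x∈p′ = ∈⋃⁻ ps x∈ps in p′ , there p′∈ps , x∈p′

∈⋃⁺ : ∀ {n} {x : Fin n} {p} ps → p ∈ ps → x ∈ˢ p → x ∈ˢ ⋃ ps
∈⋃⁺ (p ∷ ps) (here ≡.refl) x∈p = x∈p∪q⁺ (inj₁ x∈p)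
∈⋃⁺ (p ∷ ps) (there p∈ps)  x∈p = x∈p∪q⁺ {p = p} (inj₂ (∈⋃⁺ ps p∈ps x∈p))

-- Congruences and coprime cofactors.

%≡%⇒∣∸ : ∀ n .{{_ : NonZero n}} x y → x % n ≡ y % n → n ∣ y ∸ x
%≡%⇒∣∸ n x y x%n≡y%n = divides (y / n ∸ x / n) (begin
  y ∸ x                                                      ≡⟨ ≡.cong₂ _∸_ (m≡m%n+[m/n]*n y n) (m≡m%n+[m/n]*n x n) ⟩
  (y % n ℕ.+ y / n ℕ.* n) ∸ (x % n ℕ.+ x / n ℕ.* n)          ≡⟨ ≡.cong (λ r → (y % n ℕ.+ y / n ℕ.* n) ∸ (r ℕ.+ x / n ℕ.* n)) x%n≡y%n ⟩
  (y % n ℕ.+ y / n ℕ.* n) ∸ (y % n ℕ.+ x / n ℕ.* n)          ≡⟨ ℕ.[m+n]∸[m+o]≡n∸o (y % n) _ _ ⟩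
  y / n ℕ.* n ∸ x / n ℕ.* n                                  ≡⟨ ℕ.*-distribʳ-∸ n (y / n) (x / n) ⟨
  (y / n ∸ x / n) ℕ.* n                                      ∎)
  where open ≡-Reasoning

-- `M = k d` divides `n k` and `M = k′ d′` divides `n k′`, so it divides their gcd, which is `n` by
-- coprimality.
coprime-cofactors-∣ : ∀ {M d d′ k k′ n} → Coprime k k′ → k ℕ.* d ≡ M → k′ ℕ.* d′ ≡ M → d ∣ n → d′ ∣ n → M ∣ n
coprime-cofactors-∣ {M} {d} {d′} {k} {k′} {n} coprime kd≡M k′d′≡M d∣n d′∣n =
  ≡.subst (M ∣_) gcd≡n (gcd-greatest (scale kd≡M d∣n) (scale k′d′≡M d′∣n))
  where
  scale : ∀ {k d} → k ℕ.* d ≡ M → d ∣ n → M ∣ n ℕ.* k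
  scale {k} kd≡M d∣n = ≡.subst₂ _∣_ kd≡M (ℕ.*-comm k n) (ℕ.*-monoʳ-∣ k d∣n)
  gcd≡n : gcd (n ℕ.* k) (n ℕ.* k′) ≡ n
  gcd≡n = ≡.trans (≡.sym (c*gcd[m,n]≡gcd[cm,cn] n k k′))
    (≡.trans (≡.cong (n ℕ.*_) (coprime⇒gcd≡1 coprime)) (ℕ.*-identityʳ n))

-- Cosets in the cyclic group, as sets of exponents.

module _ {M : ℕ} where

  -- The exponents of the coset ψᵃ⟨ψᵈ⟩; index 0 stands for the zero element.
  coset : (d : ℕ) .{{_ : NonZero d}} → ℕ → Subset (suc M)
  coset d a = outside ∷ Vec.tabulate (λ i → does (toℕ i % d ℕ.≟ a))

  module _ (d : ℕ) .{{_ : NonZero d}} {a : ℕ} where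

    0∉coset : ¬ (zero ∈ˢ coset d a)
    0∉coset ()

    ∈coset⁺ : ∀ {i} → toℕ i % d ≡ a → suc i ∈ˢ coset d a
    ∈coset⁺ {i} i%d≡a = Vec.there (lookup⇒[]= i _
      (≡.trans (lookup∘tabulate _ i) (dec-true (toℕ i % d ℕ.≟ a) i%d≡a)))

    ∈coset⁻ : ∀ {i} → suc i ∈ˢ coset d a → toℕ i % d ≡ a
    ∈coset⁻ {i} (Vec.there i∈) with toℕ i % d ℕ.≟ a | ≡.trans (≡.sym (lookup∘tabulate _ i)) ([]=⇒lookup i∈)
    ... | yes i%d≡a | _ = i%d≡a
    ... | no  i%d≢a | eq with () ← ≡.trans (≡.sym (dec-false (toℕ i % d ℕ.≟ a) i%d≢a)) eq

    -- Counting is summing ones, so `sumTo-periodic` yields the size here just as it later rewrites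
    -- the sum of the elements.
    ∣coset∣ : ∀ {k} → k ℕ.* d ≡ M → a < d → ∣ coset d a ∣ ≡ k
    ∣coset∣ {k} ≡.refl a<d = begin
      ∣ Vec.tabulate {n = k ℕ.* d} (λ i → does (toℕ i % d ℕ.≟ a)) ∣  ≡⟨ ∣tabulate∣≡sum {k ℕ.* d} _ ⟩
      sumTo (k ℕ.* d) (λ i → if does (i % d ℕ.≟ a) then 1 else 0)    ≡⟨ sumTo-periodic d a<d k (λ _ → 1) ⟩
      sumTo k (λ _ → 1)                                             ≡⟨ CMSum.sum-replicate ℕ.+-0-commutativeMonoid k ⟩
      k × 1                                                         ≡⟨ ×1≡ k ⟩
      k                                                             ∎
      where
      open ≡-Reasoning
      open PeriodicSums ℕ.+-0-commutativeMonoid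
      open CMMult ℕ.+-0-commutativeMonoid using (_×_)
      ×1≡ : ∀ n → n × 1 ≡ n
      ×1≡ zero    = ≡.refl
      ×1≡ (suc n) = ≡.cong suc (×1≡ n)

    coset-nonempty : a < d → d ≤ M → Nonempty (coset d a)
    coset-nonempty a<d d≤M = suc (fromℕ< a<M) ,
      ∈coset⁺ (≡.trans (≡.cong (_% d) (toℕ-fromℕ< a<M)) (m<n⇒m%n≡m a<d))
      where a<M = ℕ.<-≤-trans a<d d≤M

  cosets-disjoint : ∀ d .{{_ : NonZero d}} {a b} → a ≢ b → Empty (coset d a ∩ coset d b)
  cosets-disjoint d {a} {b} a≢b (zero , 0∈) = 0∉coset d {a} (proj₁ (x∈p∩q⁻ (coset d a) (coset d b) 0∈))
  cosets-disjoint d {a} {b} a≢b (suc i , i∈) =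
    let i∈a , i∈b = x∈p∩q⁻ (coset d a) (coset d b) i∈
    in a≢b (≡.trans (≡.sym (∈coset⁻ d i∈a)) (∈coset⁻ d i∈b))

  -- Two common exponents agree modulo `d` and modulo `d′`, hence differ by a multiple of `M`; both
  -- lie below `M`, so they coincide.
  coset∩coset : ∀ {k k′} d d′ .{{_ : NonZero d}} .{{_ : NonZero d′}} a a′ → Coprime k k′ →
    k ℕ.* d ≡ M → k′ ℕ.* d′ ≡ M → ∣ coset d a ∩ coset d′ a′ ∣ ≤ 1
  coset∩coset d d′ a a′ coprime kd≡M k′d′≡M = ∣p∣≤1 _ unique
    where
    -- Truncated subtraction handles one order at a time: a positive `toℕ j ∸ toℕ i` would be a
    -- multiple of `M` below `M`. Antisymmetry then combines the two orders.
    below : ∀ (i j : Fin M) → toℕ i % d ≡ toℕ j % d → toℕ i % d′ ≡ toℕ j % d′ → toℕ j ≤ toℕ i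
    below i j i≡j i≡′j with toℕ j ∸ toℕ i in eq | coprime-cofactors-∣ coprime kd≡M k′d′≡M
      (%≡%⇒∣∸ d (toℕ i) (toℕ j) i≡j) (%≡%⇒∣∸ d′ (toℕ i) (toℕ j) i≡′j)
    ... | zero  | _   = ℕ.m∸n≡0⇒m≤n eq
    ... | suc n | M∣n = contradiction (∣⇒≤ M∣n)
      (ℕ.<⇒≱ (ℕ.≤-<-trans (≡.subst (_≤ toℕ j) eq (ℕ.m∸n≤m (toℕ j) (toℕ i))) (toℕ<n j)))
    unique : ∀ {x y} → x ∈ˢ coset d a ∩ coset d′ a′ → y ∈ˢ coset d a ∩ coset d′ a′ → x ≡ y
    unique {zero} x∈ _ = contradiction (proj₁ (x∈p∩q⁻ (coset d a) (coset d′ a′) x∈)) (0∉coset d {a})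
    unique {suc i} {zero} _ y∈ = contradiction (proj₁ (x∈p∩q⁻ (coset d a) (coset d′ a′) y∈)) (0∉coset d {a})
    unique {suc i} {suc j} x∈ y∈ =
      let i∈a , i∈a′ = x∈p∩q⁻ (coset d a) (coset d′ a′) x∈
          j∈a , j∈a′ = x∈p∩q⁻ (coset d a) (coset d′ a′) y∈
          i≡j  = ≡.trans (∈coset⁻ d i∈a) (≡.sym (∈coset⁻ d j∈a))
          i≡′j = ≡.trans (∈coset⁻ d′ i∈a′) (≡.sym (∈coset⁻ d′ j∈a′))
      in ≡.cong suc (toℕ-injective (ℕ.≤-antisym
           (below j i (≡.sym i≡j) (≡.sym i≡′j)) (below i j i≡j i≡′j)))

-- The half-set and the Heffter systems.

module CosetSystems {M v : ℕ} (F : CyclicField M) (M≡v+v : M ≡ v ℕ.+ v) (v-odd : v % 2 ≡ 1) where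

  open CyclicField F renaming (ring to K)
  open CommutativeRing K hiding (zero)
  open PrimitiveRoot root
  open Points root using (point-injective; pow≈point; index)
  open RingProperties ring using (-‿distribˡ-*)
  open GroupProperties +-group using () renaming (∙-cancelˡ to +-cancelˡ; inverseˡ-unique to +-inverseˡ-unique)
  open PeriodicSums +-commutativeMonoid using (sumTo; sumTo-last; sumTo-periodic)
  open SemiringSum semiring using (*-distribˡ-sum; sum-cong-≋)

  0<v : 0 < v
  0<v = ℕ.n≢0⇒n>0 λ v≡0 → ℕ.0≢1+n (≡.trans (≡.cong (_% 2) (≡.sym v≡0)) v-odd)

  M≡2v : M ≡ 2 ℕ.* v
  M≡2v = ≡.trans M≡v+v (≡.cong (v ℕ.+_) (≡.sym (ℕ.+-identityʳ v)))

  2∣M : 2 ∣ M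
  2∣M = divides v (≡.trans M≡2v (ℕ.*-comm 2 v))

  0<M : 0 < M
  0<M = ≡.subst (0 <_) (≡.sym M≡v+v) (ℕ.<-≤-trans 0<v (ℕ.m≤m+n v v))

  instance
    M-nonZero : NonZero M
    M-nonZero = >-nonZero 0<M

  -- The additive group, enumerated by `point`: index 0 is zero and index `suc i` the power with
  -- exponent `i`, so the sets `coset d a` are subsets of it as they stand.
  G : AbelianGroupOfOrder (suc M)
  G = record
    { abelianGroup = +-abelianGroup
    ; enumeration  = record
      { to        = point
      ; from      = proj₁ ∘ point-surjective
      ; to-cong   = reflexive ∘ ≡.cong point
      ; from-cong = λ {x} {y} x≈y → point-injective 1≉0 _ _
          (trans (sym (proj₂ (point-surjective x))) (trans x≈y (proj₂ (point-surjective y))))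
      ; inverse   = (λ {x} eq → trans (reflexive (≡.cong point eq)) (sym (proj₂ (point-surjective x))))
                  , (λ {i} {y} y≈i → point-injective 1≉0 _ _ (trans (sym (proj₂ (point-surjective y))) y≈i))
      }
    }

  from : Carrier → Fin (suc M)
  from = Inverse.from (AbelianGroupOfOrder.enumeration G)

  from-≡ : ∀ {y i} → y ≈ point i → from y ≡ i
  from-≡ = Inverse.inverseʳ (AbelianGroupOfOrder.enumeration G)

  -- Multiplication by `pow v` exchanges `pow v` and `1#`, so it fixes `pow v + 1#`, which vanishes
  -- by `pow-free` since `0 < v < M`.
  pow-v : pow v ≈ - 1#
  pow-v = +-inverseˡ-unique _ _ (pow-free v 0<v (≡.subst (v <_) (≡.sym M≡v+v) (ℕ.m<m+n v 0<v)) _ (begin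
    pow v * (pow v + 1#)            ≈⟨ distribˡ _ _ _ ⟩
    pow v * pow v + pow v * 1#      ≈⟨ +-cong (pow-+ v v) (sym (*-identityʳ _)) ⟨
    pow (v ℕ.+ v) + pow v           ≡⟨ ≡.cong (λ n → pow n + pow v) M≡v+v ⟨
    pow M + pow v                   ≈⟨ +-congʳ pow-M ⟩
    1# + pow v                      ≈⟨ +-comm _ _ ⟩
    pow v + 1#                      ∎))
    where open SetoidReasoning setoid

  -pow : ∀ n → - pow n ≈ pow (v ℕ.+ n)
  -pow n = begin
    - pow n           ≈⟨ -‿cong (*-identityˡ _) ⟨
    - (1# * pow n)    ≈⟨ -‿distribˡ-* 1# (pow n) ⟩
    - 1# * pow n      ≈⟨ *-congʳ pow-v ⟨
    pow v * pow n     ≈⟨ pow-+ v n ⟨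
    pow (v ℕ.+ n)     ∎
    where open SetoidReasoning setoid

  V : Subset (suc M)
  V = coset 2 0

  -- Negation adds `v` to the exponent and `v` is odd, so it flips the parity; reducing the exponent
  -- modulo the even number `M` does not affect it.
  halfSet : IsHalfSet G V
  halfSet = record { ε∉V = ε∉V ; oneOfPair = oneOfPair }
    where
    ε∉V : ¬ (from 0# ∈ˢ V)
    ε∉V ε∈V = 0∉coset {M} 2 {0} (≡.subst (_∈ˢ V) (from-≡ refl) ε∈V)

    index%2 : ∀ n → toℕ (fromℕ< (m%n<n n M)) % 2 ≡ n % 2
    index%2 n = ≡.trans (≡.cong (_% 2) (toℕ-fromℕ< (m%n<n n M))) (m∣n⇒o%n%m≡o%m 2 M n 2∣M)

    [v+n]%2 : ∀ n → (v ℕ.+ n) % 2 ≡ (1 ℕ.+ n % 2) % 2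
    [v+n]%2 n = ≡.trans (%-distribˡ-+ v n 2) (≡.cong (λ r → (r ℕ.+ n % 2) % 2) v-odd)

    oneOfPair : ∀ g → ¬ (g ≈ 0#) → (from g ∈ˢ V ∧ ¬ (from (- g) ∈ˢ V)) ⊎ (¬ (from g ∈ˢ V) ∧ from (- g) ∈ˢ V)
    oneOfPair g g≉0 with point-surjective g
    ... | zero  , g≈0 = contradiction g≈0 g≉0
    ... | suc i , g≈i = split (toℕ i % 2) ≡.refl (m%n<n (toℕ i) 2)
      where
      n = toℕ i
      from-g≡ : from (- g) ≡ index (v ℕ.+ n)
      from-g≡ = from-≡ (trans (-‿cong g≈i) (trans (-pow n) (pow≈point (v ℕ.+ n))))
      split : ∀ b → n % 2 ≡ b → b < 2 →
        (suc i ∈ˢ V ∧ ¬ (from (- g) ∈ˢ V)) ⊎ (¬ (suc i ∈ˢ V) ∧ from (- g) ∈ˢ V)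
      split 0 n%2≡0 _ = inj₁ (∈coset⁺ 2 n%2≡0 , λ -g∈V → ℕ.0≢1+n (≡.trans
        (≡.sym (∈coset⁻ 2 (≡.subst (_∈ˢ V) from-g≡ -g∈V)))
        (≡.trans (index%2 (v ℕ.+ n)) (≡.trans ([v+n]%2 n) (≡.cong (λ r → (1 ℕ.+ r) % 2) n%2≡0)))))
      split 1 n%2≡1 _ = inj₂ ((λ g∈V → ℕ.0≢1+n (≡.trans (≡.sym (∈coset⁻ 2 g∈V)) n%2≡1)) ,
        ≡.subst (_∈ˢ V) (≡.sym from-g≡) (∈coset⁺ 2 (≡.trans (index%2 (v ℕ.+ n))
          (≡.trans ([v+n]%2 n) (≡.cong (λ r → (1 ℕ.+ r) % 2) n%2≡1)))))
      split (suc (suc _)) _ (s≤s (s≤s ()))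

  -- Multiplication by `pow d` permutes the coset cyclically and so fixes its sum; `2 ≤ k` gives
  -- `d < M`, as `pow-free` demands.
  Σ-coset : ∀ {k} d .{{_ : NonZero d}} a → a < d → k ℕ.* d ≡ M → 2 ≤ k → ΣG G (coset d a) ≈ 0#
  Σ-coset {k} d a a<d kd≡M 2≤k = begin
    0# + sumᶠ (λ i → if lookup (Vec.tabulate b) i then pow (toℕ i) else 0#)
      ≈⟨ +-identityˡ _ ⟩
    sumᶠ (λ i → if lookup (Vec.tabulate b) i then pow (toℕ i) else 0#)
      ≈⟨ sum-cong-≋ {M} (λ i → reflexive (≡.cong (if_then pow (toℕ i) else 0#) (lookup∘tabulate b i))) ⟩
    sumTo M (λ i → if does (i % d ℕ.≟ a) then pow i else 0#)
      ≡⟨ ≡.cong (λ n → sumTo n (λ i → if does (i % d ℕ.≟ a) then pow i else 0#)) kd≡M ⟨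
    sumTo (k ℕ.* d) (λ i → if does (i % d ℕ.≟ a) then pow i else 0#)
      ≈⟨ sumTo-periodic d a<d k pow ⟩
    sumTo k f
      ≈⟨ pow-free d (ℕ.≤-<-trans z≤n a<d) d<M _ shift ⟩
    0#  ∎
    where
    open SetoidReasoning setoid
    sumᶠ = CMSum.sum +-commutativeMonoid {M}
    b : Fin M → Bool
    b i = does (toℕ i % d ℕ.≟ a)
    f : ℕ → Carrier
    f j = pow (j ℕ.* d ℕ.+ a)
    d<M : d < M
    d<M = ≡.subst (d <_) kd≡M (ℕ.<-≤-trans
      (ℕ.m<m+n d (≡.subst (0 <_) (≡.sym (ℕ.+-identityʳ d)) (ℕ.≤-<-trans z≤n a<d))) (ℕ.*-monoˡ-≤ d 2≤k))
    fk≈f0 : f k ≈ f 0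
    fk≈f0 = begin
      pow (k ℕ.* d ℕ.+ a)    ≡⟨ ≡.cong (λ n → pow (n ℕ.+ a)) kd≡M ⟩
      pow (M ℕ.+ a)          ≈⟨ pow-+ M a ⟩
      pow M * pow a          ≈⟨ *-congʳ pow-M ⟩
      1# * pow a             ≈⟨ *-identityˡ _ ⟩
      pow a                  ∎
    shift : pow d * sumTo k f ≈ sumTo k f
    shift = begin
      pow d * sumTo k f      ≈⟨ *-distribˡ-sum {k} (pow d) (f ∘ toℕ) ⟩
      sumTo k (λ j → pow d * f j)
        ≈⟨ sum-cong-≋ {k} (λ j → trans (sym (pow-+ d _)) (reflexive (≡.cong pow (≡.sym (ℕ.+-assoc d _ a))))) ⟩
      sumTo k (f ∘ suc)
        -- Splitting the sum of `f 0, ..., f k` at its first and at its last term gives the two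
        -- sides plus `f 0` and `f k`, and these agree because `pow M = 1`.
        ≈⟨ +-cancelˡ (f 0) _ _ (trans (sumTo-last k f) (trans (+-congˡ fk≈f0) (+-comm _ _))) ⟩
      sumTo k f              ∎

  module _ (k : ℕ) (2≤k : 2 ≤ k) (c : ℕ) (v≡c*k : v ≡ c ℕ.* k) where

    -- This is `M / k`, so `pow d` generates the subgroup of order `k`; being even, it keeps each
    -- coset within one parity class of exponents.
    d : ℕ
    d = 2 ℕ.* c

    k*d≡M : k ℕ.* d ≡ M
    k*d≡M = ≡.trans (CommutativeSemigroupProperties.x∙yz≈y∙xz ℕ.*-commutativeSemigroup k 2 c)
      (≡.trans (≡.cong (2 ℕ.*_) (≡.trans (ℕ.*-comm k c) (≡.sym v≡c*k))) (≡.sym M≡2v))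

    0<d : 0 < d
    0<d = ℕ.n≢0⇒n>0 λ d≡0 → ℕ.m<n⇒n≢0 0<M
      (≡.trans (≡.sym k*d≡M) (≡.trans (≡.cong (k ℕ.*_) d≡0) (ℕ.*-zeroʳ k)))

    instance
      d-nonZero : NonZero d
      d-nonZero = >-nonZero 0<d

    d≤M : d ≤ M
    d≤M = ∣⇒≤ (divides k (≡.sym k*d≡M))

    -- The even residues modulo `d = 2 c` are the `2 r` with `r < c`, one for each block.
    block : Fin c → Subset (suc M)
    block r = coset d (2 ℕ.* toℕ r)

    2r<d : ∀ (r : Fin c) → 2 ℕ.* toℕ r < d
    2r<d r = ℕ.*-monoʳ-< 2 (toℕ<n r)

    system : List (Subset (suc M))
    system = List.tabulate block

    -- Reduction modulo the even number `d` preserves parity. So blocks contain only even exponents,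
    -- and an even exponent lies in the block indexed by half its residue.
    system-union : ⋃ system ≡ V
    system-union = ⊆-antisym ⋃⊆V V⊆⋃
      where
      block⊆V : ∀ r {x} → x ∈ˢ block r → x ∈ˢ V
      block⊆V r {zero}  0∈ = contradiction 0∈ (0∉coset {M} d)
      block⊆V r {suc i} i∈ = ∈coset⁺ 2 (≡.trans (≡.sym (m∣n⇒o%n%m≡o%m 2 d (toℕ i) (ℕ.m∣m*n c)))
        (≡.trans (≡.cong (_% 2) (≡.trans (∈coset⁻ d i∈) (ℕ.*-comm 2 (toℕ r)))) (m*n%n≡0 (toℕ r) 2)))
      ⋃⊆V : ∀ {x} → x ∈ˢ ⋃ system → x ∈ˢ V
      ⋃⊆V x∈⋃ with ∈⋃⁻ system x∈⋃
      ... | p , p∈ , x∈p with ∈-tabulate⁻ p∈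
      ... | r , ≡.refl = block⊆V r x∈p
      V⊆⋃ : ∀ {x} → x ∈ˢ V → x ∈ˢ ⋃ system
      V⊆⋃ {zero}  0∈V = contradiction 0∈V (0∉coset {M} 2)
      V⊆⋃ {suc i} i∈V = ∈⋃⁺ system (∈-tabulate⁺ {f = block} r) (∈coset⁺ d i%d≡2r)
        where
        e = toℕ i % d
        e/2<c : e / 2 < c
        e/2<c = m<n*o⇒m/o<n (≡.subst (e <_) (ℕ.*-comm 2 c) (m%n<n (toℕ i) d))
        r : Fin c
        r = fromℕ< e/2<c
        i%d≡2r : e ≡ 2 ℕ.* toℕ r
        i%d≡2r = begin
          e                         ≡⟨ m≡m%n+[m/n]*n e 2 ⟩
          e % 2 ℕ.+ e / 2 ℕ.* 2     ≡⟨ ≡.cong (ℕ._+ e / 2 ℕ.* 2) (≡.trans (m∣n⇒o%n%m≡o%m 2 d (toℕ i) (ℕ.m∣m*n c)) (∈coset⁻ 2 i∈V)) ⟩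
          e / 2 ℕ.* 2               ≡⟨ ℕ.*-comm (e / 2) 2 ⟩
          2 ℕ.* (e / 2)             ≡⟨ ≡.cong (2 ℕ.*_) (toℕ-fromℕ< e/2<c) ⟨
          2 ℕ.* toℕ r               ∎
          where open ≡-Reasoning

    heffterSystem : IsHeffterSystem G V k system
    heffterSystem = record
      { partition = record
        { nonempty = AllProperties.tabulate⁺ (λ r → coset-nonempty d (2r<d r) d≤M)
        ; disjoint = AllPairsProperties.tabulate⁺ (λ r≢s → cosets-disjoint d
            (λ 2r≡2s → r≢s (toℕ-injective (ℕ.*-cancelˡ-≡ _ _ 2 2r≡2s))))
        ; union    = system-union
        }
      ; blockSize = λ B∈ → let r , B≡ = ∈-tabulate⁻ B∈ in
          ≡.trans (≡.cong ∣_∣ B≡) (∣coset∣ d k*d≡M (2r<d r))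
      ; zeroSum   = λ B∈ → let r , B≡ = ∈-tabulate⁻ B∈ in
          trans (reflexive (≡.cong (ΣG G) B≡)) (Σ-coset d (2 ℕ.* toℕ r) (2r<d r) k*d≡M 2≤k)
      }

  systems-orthogonal : ∀ {k k′} (2≤k : 2 ≤ k) (2≤k′ : 2 ≤ k′) {c c′} (v≡ck : v ≡ c ℕ.* k) (v≡c′k′ : v ≡ c′ ℕ.* k′) →
    Coprime k k′ → Orthogonal (system k 2≤k c v≡ck) (system k′ 2≤k′ c′ v≡c′k′)
  systems-orthogonal {k} {k′} 2≤k 2≤k′ {c} {c′} v≡ck v≡c′k′ coprime B∈ C∈ with ∈-tabulate⁻ B∈ | ∈-tabulate⁻ C∈
  ... | r , ≡.refl | s , ≡.refl = coset∩coset (2 ℕ.* c) (2 ℕ.* c′)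
    {{d-nonZero k 2≤k c v≡ck}} {{d-nonZero k′ 2≤k′ c′ v≡c′k′}} _ _ coprime
    (k*d≡M k 2≤k c v≡ck) (k*d≡M k′ 2≤k′ c′ v≡c′k′)

-- Arithmetic of the product of the block sizes, and assembly.

∣∏ : ∀ {r} (k : Fin r → ℕ) i → k i ∣ ∏ k
∣∏ k zero    = ℕ.m∣m*n (∏ (k ∘ suc))
∣∏ k (suc i) = ℕ.∣n⇒∣m*n (k zero) (∣∏ (k ∘ suc) i)

parity≡1ℙ⇒%2≡1 : ∀ n → parity n ≡ 1ℙ → n % 2 ≡ 1
parity≡1ℙ⇒%2≡1 zero          ()
parity≡1ℙ⇒%2≡1 (suc zero)    _   = ≡.refl
parity≡1ℙ⇒%2≡1 (suc (suc n)) odd = parity≡1ℙ⇒%2≡1 n odd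

∏-odd : ∀ {r} (k : Fin r → ℕ) → (∀ i → parity (k i) ≡ 1ℙ) → ∏ k % 2 ≡ 1
∏-odd {zero}  k odd = ≡.refl
∏-odd {suc r} k odd = ≡.trans (%-distribˡ-* (k zero) (∏ (k ∘ suc)) 2)
  (≡.cong₂ (λ a b → (a ℕ.* b) % 2) (parity≡1ℙ⇒%2≡1 (k zero) (odd zero)) (∏-odd (k ∘ suc) (odd ∘ suc)))

-- The field has `suc (v + v)` elements, while `MOHS` asks for order `2 * v + 1`. With a variable
-- `N` for the order, matching on the equation transports all data at once.
mohs : ∀ {N v r} {k : Fin r → ℕ} → N ≡ 2 ℕ.* v ℕ.+ 1 → 7 ≤ 2 ℕ.* v ℕ.+ 1 →
  (G : AbelianGroupOfOrder N) (V : Subset N) → IsHalfSet G V →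
  (systems : Fin r → List (Subset N)) → (∀ i → IsHeffterSystem G V (k i) (systems i)) →
  (∀ i j → i ≢ j → Orthogonal (systems i) (systems j)) → MOHS v k
mohs ≡.refl 7≤N G V halfSet systems heffter orthogonal = record
  { order≥7    = 7≤N
  ; group      = G
  ; V          = V
  ; halfSet    = halfSet
  ; systems    = systems
  ; heffter    = heffter
  ; orthogonal = orthogonal
  }

open import Data.Nat.Base using (_+_; _*_)

theorem1p13 : (r : ℕ) → 1 ≤ r → (k : Fin r → ℕ) →
    (∀ i j → i ≢ j → Coprime (k i) (k j)) →
    (∀ i → parity (k i) ≡ 1ℙ) →
    (∀ i → 3 ≤ k i) →
    (q : ℕ) → q ≡ 2 * ∏ k + 1 → IsPrimePower q →
    MOHS ((q ∸ 1) / 2) k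
theorem1p13 r 1≤r k coprime odd 3≤k q q≡2v+1 (p , m , p-prime , _ , q≡p^m) =
  ≡.subst (λ v → MOHS v k) (≡.sym [q∸1]/2≡v)
    (mohs 1+v+v≡2v+1 (ℕ.+-monoˡ-≤ 1 (ℕ.*-monoʳ-≤ 2 3≤v)) G V halfSet systems
      (λ i → heffterSystem (k i) (2≤k i) (cofactors i) (v≡c*k i))
      (λ i j i≢j → systems-orthogonal (2≤k i) (2≤k j) (v≡c*k i) (v≡c*k j) (coprime i j i≢j)))
  where
  v = ∏ k

  v-odd : v % 2 ≡ 1
  v-odd = ∏-odd k odd

  0<v : 0 < v
  0<v = ℕ.n≢0⇒n>0 λ v≡0 → ℕ.0≢1+n (≡.trans (≡.cong (_% 2) (≡.sym v≡0)) v-odd)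

  3≤v : 3 ≤ v
  -- Since `1 ≤ r`, there is a first block size; it is at least 3 and divides `v > 0`. This yields
  -- order at least 7.
  3≤v = ℕ.≤-trans (3≤k (fromℕ< 1≤r)) (∣⇒≤ {{>-nonZero 0<v}} (∣∏ k (fromℕ< 1≤r)))

  1+v+v≡2v+1 : suc (v + v) ≡ 2 * v + 1
  1+v+v≡2v+1 = ≡.trans (ℕ.+-comm 1 (v + v)) (≡.cong (λ n → v + n + 1) (≡.sym (ℕ.+-identityʳ v)))

  [q∸1]/2≡v : (q ∸ 1) / 2 ≡ v
  [q∸1]/2≡v = begin
    (q ∸ 1) / 2            ≡⟨ ≡.cong (λ n → (n ∸ 1) / 2) q≡2v+1 ⟩
    (2 * v + 1 ∸ 1) / 2    ≡⟨ ≡.cong (_/ 2) (ℕ.m+n∸n≡m (2 * v) 1) ⟩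
    2 * v / 2              ≡⟨ ≡.cong (_/ 2) (ℕ.*-comm 2 v) ⟩
    v * 2 / 2              ≡⟨ m*n/n≡m v 2 ⟩
    v                      ∎
    where open ≡-Reasoning

  open CosetSystems {v + v} {v}
    (cyclicField-exists p-prime m (v + v) (ℕ.<-≤-trans 0<v (ℕ.m≤m+n v v))
      (≡.trans 1+v+v≡2v+1 (≡.trans (≡.sym q≡2v+1) q≡p^m)))
    ≡.refl v-odd using (G; V; halfSet; system; heffterSystem; systems-orthogonal)

  2≤k : ∀ i → 2 ≤ k i
  2≤k i = ℕ.≤-trans (ℕ.n≤1+n 2) (3≤k i)

  cofactors : Fin r → ℕ
  cofactors i = ℕ.quotient (∣∏ k i)

  v≡c*k : ∀ i → v ≡ cofactors i * k i
  v≡c*k i = ℕ._∣_.equality (∣∏ k i)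

  systems : Fin r → List (Subset (suc (v + v)))
  systems i = system (k i) (2≤k i) (cofactors i) (v≡c*k i)
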